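{- Let $\{z_n\}_{n\ge 0}$ be a sequence of positive numbers satisfying the recurrence $$z_{n+1}=a_nz_{n}+b_nz_{n-1}\qquad (n\ge 1),$$ where $\{a_n\}$ and $\{b_n\}$ are real sequences. Assume that for all $n\geq 1$ we have $b_{n+1}\geq b_n>0$, $a_{n+1}\geq a_n>0$ and $$21a_n^2+11 a_{n+1}a_n-4b_{n-1}\geq0.$$ For each $n$ let $$f_n(x)=\left[(a_{n+1}a_n+b_{n+1})x+a_{n+1}b_n\right](x-a_{n-1})x^6-b_{n-1}(a_nx+b_n)^4.$$ If there exist a positive integer $N$ and a sequence $\{\lambda_n\}$ such that for all $n\geq N+1$, $$\frac{z_{n}}{z_{n-1}}\geq \lambda_n\geq a_n,\quad f_n''(\lambda_n)>0,\quad f_n'(\lambda_n)>0,\quad f_n(\lambda_n)>0,$$ then the ratio sequence $\{z_{n+1}/z_n\}_{n\ge N}$ is ratio log-convex.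
   Context: A sequence $\{x_n\}$ of positive numbers is log-convex if $x_{n-1}x_{n+1}\ge x_n^2$ for all indices $n$ for which the three terms are defined (i.e. all but the first index), and log-concave if $x_{n-1}x_{n+1}\le x_n^2$ for all such $n$. A sequence $\{x_n\}$ of positive numbers is called ratio log-convex (resp. ratio log-concave) if the sequence $\{x_{n+1}/x_n\}$ is log-convex (resp. log-concave). -}

module Defs where

open import Data.Nat.Base as ℕ using (ℕ; zero; suc)
import Data.Nat.Properties as ℕₚ
open import Data.Integer.Base using (+_; -[1+_])
open import Data.Rational.Base as ℚ using (ℚ; 0ℚ; 1ℚ; ½; ∣_∣; 1/_; positive)
import Data.Rational.Properties as ℚₚ
open import Data.Rational.Solver using (module +-*-Solver)
open import Data.List.Base using (List; []; _∷_; map)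
open import Data.Product.Base using (∃-syntax; _×_; _,_; proj₁; proj₂)
open import Relation.Binary.PropositionalEquality using (_≡_; refl; sym; trans; cong; cong₂; subst)

half-pos : ∀ ε → 0ℚ ℚ.< ε → 0ℚ ℚ.< ½ ℚ.* ε
half-pos ε 0<ε = ℚₚ.positive⁻¹ (½ ℚ.* ε) {{ℚₚ.pos*pos⇒pos ½ ε {{positive 0<ε}}}}

half+half : ∀ ε → ½ ℚ.* ε ℚ.+ ½ ℚ.* ε ≡ ε
half+half ε = trans (sym (ℚₚ.*-distribʳ-+ ε ½ ½)) (ℚₚ.*-identityˡ ε)

*-pos : ∀ {p q} → 0ℚ ℚ.< p → 0ℚ ℚ.< q → 0ℚ ℚ.< p ℚ.* q
*-pos {p} {q} 0<p 0<q =
  ℚₚ.positive⁻¹ (p ℚ.* q) {{ℚₚ.pos*pos⇒pos p {{positive 0<p}} q {{positive 0<q}}}}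

inv : (p : ℚ) → 0ℚ ℚ.< p → ℚ
inv p 0<p = (1/ p) {{ℚₚ.pos⇒nonZero p {{positive 0<p}}}}

inv-pos : ∀ p (0<p : 0ℚ ℚ.< p) → 0ℚ ℚ.< inv p 0<p
inv-pos p 0<p = ℚₚ.positive⁻¹ (inv p 0<p) {{ℚₚ.1/pos⇒pos p {{positive 0<p}}}}

inv-inverseʳ : ∀ p (0<p : 0ℚ ℚ.< p) → p ℚ.* inv p 0<p ≡ 1ℚ
inv-inverseʳ p 0<p = ℚₚ.*-inverseʳ p {{ℚₚ.pos⇒nonZero p {{positive 0<p}}}}

*-cancel-inv : ∀ p (0<p : 0ℚ ℚ.< p) q → p ℚ.* (q ℚ.* inv p 0<p) ≡ q
*-cancel-inv p 0<p q = trans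
  (+-*-Solver.solve 3 (λ p q r → p :* (q :* r) := (p :* r) :* q) refl p q (inv p 0<p))
  (trans (cong (ℚ._* q) (inv-inverseʳ p 0<p)) (ℚₚ.*-identityˡ q))
  where open +-*-Solver

inv-antimono : ∀ p q (0<p : 0ℚ ℚ.< p) (0<q : 0ℚ ℚ.< q) →
               p ℚ.≤ q → inv q 0<q ℚ.≤ inv p 0<p
inv-antimono p q 0<p 0<q p≤q = ℚₚ.*-cancelˡ-≤-pos q {{positive 0<q}} (begin
  q ℚ.* inv q 0<q ≡⟨ inv-inverseʳ q 0<q ⟩
  1ℚ              ≡⟨ sym (inv-inverseʳ p 0<p) ⟩
  p ℚ.* inv p 0<p ≤⟨ ℚₚ.*-monoʳ-≤-nonNeg (inv p 0<p)
                      {{ℚₚ.pos⇒nonNeg (inv p 0<p) {{positive (inv-pos p 0<p)}}}} p≤q ⟩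
  q ℚ.* inv p 0<p ∎)
  where open ℚₚ.≤-Reasoning

*-estimate : ∀ p q {r s} → ∣ p ∣ ℚ.≤ r → 0ℚ ℚ.< r → ∣ q ∣ ℚ.< s → ∣ p ℚ.* q ∣ ℚ.< r ℚ.* s
*-estimate p q {r} {s} ∣p∣≤r 0<r ∣q∣<s = begin-strict
  ∣ p ℚ.* q ∣     ≡⟨ ℚₚ.∣p*q∣≡∣p∣*∣q∣ p q ⟩
  ∣ p ∣ ℚ.* ∣ q ∣ ≤⟨ ℚₚ.*-monoʳ-≤-nonNeg ∣ q ∣ {{ℚₚ.∣-∣-nonNeg q}} ∣p∣≤r ⟩
  r ℚ.* ∣ q ∣     <⟨ ℚₚ.*-monoʳ-<-pos r {{positive 0<r}} ∣q∣<s ⟩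
  r ℚ.* s         ∎
  where open ℚₚ.≤-Reasoning

+-estimate : ∀ p q ε → ∣ p ∣ ℚ.< ½ ℚ.* ε → ∣ q ∣ ℚ.< ½ ℚ.* ε → ∣ p ℚ.+ q ∣ ℚ.< ε
+-estimate p q ε ∣p∣< ∣q∣< = begin-strict
  ∣ p ℚ.+ q ∣             ≤⟨ ℚₚ.∣p+q∣≤∣p∣+∣q∣ p q ⟩
  ∣ p ∣ ℚ.+ ∣ q ∣         <⟨ ℚₚ.+-mono-< ∣p∣< ∣q∣< ⟩
  ½ ℚ.* ε ℚ.+ ½ ℚ.* ε     ≡⟨ half+half ε ⟩
  ε                       ∎
  where open ℚₚ.≤-Reasoning

⊔-≤ : ∀ m n {k} → m ℕ.⊔ n ℕ.≤ k → m ℕ.≤ k × n ℕ.≤ k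
⊔-≤ m n m⊔n≤k = ℕₚ.m⊔n≤o⇒m≤o m n m⊔n≤k , ℕₚ.m⊔n≤o⇒n≤o m n m⊔n≤k

-- Real numbers are Cauchy sequences of rationals, identified up to _≈_.
IsCauchy : (ℕ → ℚ) → Set
IsCauchy s = ∀ ε → 0ℚ ℚ.< ε →
  ∃[ N ] (∀ m n → N ℕ.≤ m → N ℕ.≤ n → ∣ s m ℚ.- s n ∣ ℚ.< ε)

record ℝ : Set where
  constructor mkℝ
  field
    seq    : ℕ → ℚ
    cauchy : IsCauchy seq

open ℝ public

infix 4 _≈_ _<_ _≤_

_≈_ : ℝ → ℝ → Set
x ≈ y = ∀ ε → 0ℚ ℚ.< ε → ∃[ N ] (∀ n → N ℕ.≤ n → ∣ seq x n ℚ.- seq y n ∣ ℚ.< ε)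

_<_ : ℝ → ℝ → Set
x < y = ∃[ ε ] (0ℚ ℚ.< ε × ∃[ N ] (∀ n → N ℕ.≤ n → seq x n ℚ.+ ε ℚ.< seq y n))

-- Constructively equivalent to the negation of y < x.
_≤_ : ℝ → ℝ → Set
x ≤ y = ∀ ε → 0ℚ ℚ.< ε → ∃[ N ] (∀ n → N ℕ.≤ n → seq x n ℚ.≤ seq y n ℚ.+ ε)

fromℚ : ℚ → ℝ
fromℚ q .seq _        = q
fromℚ q .cauchy ε 0<ε = 0 , λ _ _ _ _ →
  subst (ℚ._< ε) (cong ∣_∣ (sym (ℚₚ.+-inverseʳ q))) 0<ε

fromℕ : ℕ → ℝ
fromℕ n = fromℚ (+ n ℚ./ 1)

0ℝ 1ℝ : ℝ
0ℝ = fromℚ 0ℚ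
1ℝ = fromℚ 1ℚ

infixl 6 _+_ _-_
infixl 7 _*_
infix  8 -_

_+_ : ℝ → ℝ → ℝ
(x + y) .seq n = seq x n ℚ.+ seq y n
(x + y) .cauchy ε 0<ε = M ℕ.⊔ N , close
  where
  open +-*-Solver using (solve; _:=_; _:+_; _:-_)

  x-cauchy = cauchy x (½ ℚ.* ε) (half-pos ε 0<ε)
  y-cauchy = cauchy y (½ ℚ.* ε) (half-pos ε 0<ε)
  M = proj₁ x-cauchy
  N = proj₁ y-cauchy

  close : ∀ m n → M ℕ.⊔ N ℕ.≤ m → M ℕ.⊔ N ℕ.≤ n →
          ∣ (seq x m ℚ.+ seq y m) ℚ.- (seq x n ℚ.+ seq y n) ∣ ℚ.< ε
  close m n m≥ n≥ = subst (λ q → ∣ q ∣ ℚ.< ε)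
    (solve 4 (λ a b c d → (a :- b) :+ (c :- d) := (a :+ c) :- (b :+ d)) refl
      (seq x m) (seq x n) (seq y m) (seq y n))
    (+-estimate (seq x m ℚ.- seq x n) (seq y m ℚ.- seq y n) ε
      (proj₂ x-cauchy m n (proj₁ (⊔-≤ M N m≥)) (proj₁ (⊔-≤ M N n≥)))
      (proj₂ y-cauchy m n (proj₂ (⊔-≤ M N m≥)) (proj₂ (⊔-≤ M N n≥))))

-_ : ℝ → ℝ
(- x) .seq n = ℚ.- seq x n
(- x) .cauchy ε 0<ε = proj₁ (cauchy x ε 0<ε) , λ m n m≥ n≥ →
  subst (λ q → ∣ q ∣ ℚ.< ε)
    (solve 2 (λ a b → a :- b := (:- b) :- (:- a)) refl (seq x n) (seq x m))
    (proj₂ (cauchy x ε 0<ε) n m n≥ m≥)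
  where open +-*-Solver

_-_ : ℝ → ℝ → ℝ
x - y = x + (- y)

eventually-bounded : ∀ x → ∃[ B ] (0ℚ ℚ.< B × ∃[ N ] (∀ n → N ℕ.≤ n → ∣ seq x n ∣ ℚ.≤ B))
eventually-bounded x with cauchy x 1ℚ (ℚₚ.positive⁻¹ 1ℚ)
... | N , x-close =
  1ℚ ℚ.+ ∣ seq x N ∣ ,
  ℚₚ.<-≤-trans (ℚₚ.positive⁻¹ 1ℚ)
    (subst (ℚ._≤ 1ℚ ℚ.+ ∣ seq x N ∣) (ℚₚ.+-identityʳ 1ℚ) (ℚₚ.+-monoʳ-≤ 1ℚ (ℚₚ.0≤∣p∣ (seq x N)))) ,
  N , λ n n≥ → begin
    ∣ seq x n ∣                                 ≡⟨ cong ∣_∣ (solve 2 (λ a b → a := (a :- b) :+ b) refl (seq x n) (seq x N)) ⟩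
    ∣ (seq x n ℚ.- seq x N) ℚ.+ seq x N ∣       ≤⟨ ℚₚ.∣p+q∣≤∣p∣+∣q∣ (seq x n ℚ.- seq x N) (seq x N) ⟩
    ∣ seq x n ℚ.- seq x N ∣ ℚ.+ ∣ seq x N ∣     ≤⟨ ℚₚ.+-monoˡ-≤ ∣ seq x N ∣ (ℚₚ.<⇒≤ (x-close n N n≥ ℕₚ.≤-refl)) ⟩
    1ℚ ℚ.+ ∣ seq x N ∣                          ∎
  where
  open ℚₚ.≤-Reasoning
  open +-*-Solver

_*_ : ℝ → ℝ → ℝ
(x * y) .seq n = seq x n ℚ.* seq y n
(x * y) .cauchy ε 0<ε = (K ℕ.⊔ L) ℕ.⊔ (M ℕ.⊔ N) , close
  where
  open +-*-Solver using (solve; _:=_; _:+_; _:*_; _:-_)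

  A = proj₁ (eventually-bounded x)
  B = proj₁ (eventually-bounded y)
  0<A = proj₁ (proj₂ (eventually-bounded x))
  0<B = proj₁ (proj₂ (eventually-bounded y))
  K = proj₁ (proj₂ (proj₂ (eventually-bounded x)))
  L = proj₁ (proj₂ (proj₂ (eventually-bounded y)))
  ∣x∣≤A = proj₂ (proj₂ (proj₂ (eventually-bounded x)))
  ∣y∣≤B = proj₂ (proj₂ (proj₂ (eventually-bounded y)))

  x-cauchy = cauchy x (½ ℚ.* ε ℚ.* inv B 0<B) (*-pos (half-pos ε 0<ε) (inv-pos B 0<B))
  y-cauchy = cauchy y (½ ℚ.* ε ℚ.* inv A 0<A) (*-pos (half-pos ε 0<ε) (inv-pos A 0<A))
  M = proj₁ x-cauchy
  N = proj₁ y-cauchy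

  close : ∀ m n → (K ℕ.⊔ L) ℕ.⊔ (M ℕ.⊔ N) ℕ.≤ m → (K ℕ.⊔ L) ℕ.⊔ (M ℕ.⊔ N) ℕ.≤ n →
          ∣ seq x m ℚ.* seq y m ℚ.- seq x n ℚ.* seq y n ∣ ℚ.< ε
  close m n m≥ n≥ = subst (λ q → ∣ q ∣ ℚ.< ε)
    (solve 4 (λ a b c d → a :* (c :- d) :+ d :* (a :- b) := a :* c :- b :* d) refl
      (seq x m) (seq x n) (seq y m) (seq y n))
    (+-estimate (seq x m ℚ.* Δy) (seq y n ℚ.* Δx) ε
      (subst (∣ seq x m ℚ.* Δy ∣ ℚ.<_) (*-cancel-inv A 0<A (½ ℚ.* ε))
        (*-estimate (seq x m) Δy (∣x∣≤A m (proj₁ (⊔-≤ K L m≥KL))) 0<A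
          (proj₂ y-cauchy m n (proj₂ (⊔-≤ M N m≥MN)) (proj₂ (⊔-≤ M N n≥MN)))))
      (subst (∣ seq y n ℚ.* Δx ∣ ℚ.<_) (*-cancel-inv B 0<B (½ ℚ.* ε))
        (*-estimate (seq y n) Δx (∣y∣≤B n (proj₂ (⊔-≤ K L n≥KL))) 0<B
          (proj₂ x-cauchy m n (proj₁ (⊔-≤ M N m≥MN)) (proj₁ (⊔-≤ M N n≥MN))))))
    where
    Δx = seq x m ℚ.- seq x n
    Δy = seq y m ℚ.- seq y n
    m≥KL = proj₁ (⊔-≤ (K ℕ.⊔ L) (M ℕ.⊔ N) m≥)
    m≥MN = proj₂ (⊔-≤ (K ℕ.⊔ L) (M ℕ.⊔ N) m≥)
    n≥KL = proj₁ (⊔-≤ (K ℕ.⊔ L) (M ℕ.⊔ N) n≥)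
    n≥MN = proj₂ (⊔-≤ (K ℕ.⊔ L) (M ℕ.⊔ N) n≥)

infixr 8 _^_

_^_ : ℝ → ℕ → ℝ
x ^ zero  = 1ℝ
x ^ suc n = x * x ^ n

record ℝ⁺ : Set where
  constructor mkℝ⁺
  field
    val : ℝ
    pos : 0ℝ < val

open ℝ⁺ public

clip-pos : ∀ {ε} q → 0ℚ ℚ.< ε → 0ℚ ℚ.< ε ℚ.⊔ q
clip-pos {ε} q 0<ε = ℚₚ.<-≤-trans 0<ε (ℚₚ.p≤p⊔q ε q)

-- If the terms of x eventually exceed ε > 0, then clipping them from below
-- at ε makes every term invertible and changes only finitely many of them.
recip : ℝ⁺ → ℝ
recip (mkℝ⁺ x (ε , 0<ε , _)) .seq n = inv (ε ℚ.⊔ seq x n) (clip-pos (seq x n) 0<ε)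
recip (mkℝ⁺ x (ε , 0<ε , N , x>ε)) .cauchy δ 0<δ = N ℕ.⊔ M , close
  where
  open ℚₚ.≤-Reasoning
  open +-*-Solver using (solve; _:=_; _:*_; _:-_)

  x-cauchy = cauchy x (ε ℚ.* (ε ℚ.* δ)) (*-pos 0<ε (*-pos 0<ε 0<δ))
  M = proj₁ x-cauchy

  u : ℕ → ℚ
  u n = ε ℚ.⊔ seq x n

  0<u : ∀ n → 0ℚ ℚ.< u n
  0<u n = clip-pos (seq x n) 0<ε

  v : ℕ → ℚ
  v n = inv (u n) (0<u n)

  u≡x : ∀ n → N ℕ.≤ n → u n ≡ seq x n
  u≡x n n≥ = ℚₚ.p≤q⇒p⊔q≡q (ℚₚ.<⇒≤ (subst (ℚ._< seq x n) (ℚₚ.+-identityˡ ε) (x>ε n n≥)))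

  v-bound : ∀ n → ∣ v n ∣ ℚ.≤ inv ε 0<ε
  v-bound n = begin
    ∣ v n ∣    ≡⟨ ℚₚ.0≤p⇒∣p∣≡p (ℚₚ.<⇒≤ (inv-pos (u n) (0<u n))) ⟩
    v n        ≤⟨ inv-antimono ε (u n) 0<ε (0<u n) (ℚₚ.p≤p⊔q ε (seq x n)) ⟩
    inv ε 0<ε  ∎

  difference : ∀ m n → v m ℚ.* (v n ℚ.* (u n ℚ.- u m)) ≡ v m ℚ.- v n
  difference m n = begin-equality
    v m ℚ.* (v n ℚ.* (u n ℚ.- u m))                    ≡⟨ solve 4 (λ a b c d → a :* (b :* (c :- d)) := (c :* b) :* a :- (d :* a) :* b) refl (v m) (v n) (u n) (u m) ⟩
    (u n ℚ.* v n) ℚ.* v m ℚ.- (u m ℚ.* v m) ℚ.* v n    ≡⟨ cong₂ (λ p q → p ℚ.* v m ℚ.- q ℚ.* v n) (inv-inverseʳ (u n) (0<u n)) (inv-inverseʳ (u m) (0<u m)) ⟩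
    1ℚ ℚ.* v m ℚ.- 1ℚ ℚ.* v n                          ≡⟨ cong₂ ℚ._-_ (ℚₚ.*-identityˡ (v m)) (ℚₚ.*-identityˡ (v n)) ⟩
    v m ℚ.- v n                                        ∎

  cancel : inv ε 0<ε ℚ.* (inv ε 0<ε ℚ.* (ε ℚ.* (ε ℚ.* δ))) ≡ δ
  cancel = begin-equality
    inv ε 0<ε ℚ.* (inv ε 0<ε ℚ.* (ε ℚ.* (ε ℚ.* δ)))    ≡⟨ solve 3 (λ i e d → i :* (i :* (e :* (e :* d))) := e :* ((e :* (d :* i)) :* i)) refl (inv ε 0<ε) ε δ ⟩
    ε ℚ.* ((ε ℚ.* (δ ℚ.* inv ε 0<ε)) ℚ.* inv ε 0<ε)    ≡⟨ *-cancel-inv ε 0<ε (ε ℚ.* (δ ℚ.* inv ε 0<ε)) ⟩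
    ε ℚ.* (δ ℚ.* inv ε 0<ε)                            ≡⟨ *-cancel-inv ε 0<ε δ ⟩
    δ                                                  ∎

  close : ∀ m n → N ℕ.⊔ M ℕ.≤ m → N ℕ.⊔ M ℕ.≤ n → ∣ v m ℚ.- v n ∣ ℚ.< δ
  close m n m≥ n≥ = begin-strict
    ∣ v m ℚ.- v n ∣                                    ≡⟨ cong ∣_∣ (sym (difference m n)) ⟩
    ∣ v m ℚ.* (v n ℚ.* (u n ℚ.- u m)) ∣                <⟨ *-estimate (v m) (v n ℚ.* (u n ℚ.- u m)) (v-bound m) (inv-pos ε 0<ε)
                                                            (*-estimate (v n) (u n ℚ.- u m) (v-bound n) (inv-pos ε 0<ε) u-close) ⟩
    inv ε 0<ε ℚ.* (inv ε 0<ε ℚ.* (ε ℚ.* (ε ℚ.* δ)))    ≡⟨ cancel ⟩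
    δ                                                  ∎
    where
    u-close : ∣ u n ℚ.- u m ∣ ℚ.< ε ℚ.* (ε ℚ.* δ)
    u-close = subst (ℚ._< ε ℚ.* (ε ℚ.* δ))
      (cong ∣_∣ (sym (cong₂ ℚ._-_ (u≡x n (proj₁ (⊔-≤ N M n≥))) (u≡x m (proj₁ (⊔-≤ N M m≥))))))
      (proj₂ x-cauchy n m (proj₂ (⊔-≤ N M n≥)) (proj₂ (⊔-≤ N M m≥)))

p≤∣p∣ : ∀ p → p ℚ.≤ ∣ p ∣
p≤∣p∣ (ℚ.mkℚ (+ _) _ _)        = ℚₚ.≤-refl
p≤∣p∣ p@(ℚ.mkℚ -[1+ _ ] _ _) = ℚₚ.<⇒≤ (ℚₚ.<-≤-trans (ℚₚ.negative⁻¹ p) (ℚₚ.0≤∣p∣ p))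

recip-pos : ∀ x → 0ℝ < recip x
recip-pos (mkℝ⁺ x (ε , 0<ε , _)) = ½ ℚ.* c , half-pos c 0<c , N , bound
  where
  open ℚₚ.≤-Reasoning

  B = proj₁ (eventually-bounded x)
  N = proj₁ (proj₂ (proj₂ (eventually-bounded x)))
  ∣x∣≤B = proj₂ (proj₂ (proj₂ (eventually-bounded x)))

  c : ℚ
  c = inv (ε ℚ.⊔ B) (clip-pos B 0<ε)

  0<c : 0ℚ ℚ.< c
  0<c = inv-pos (ε ℚ.⊔ B) (clip-pos B 0<ε)

  half-less : 0ℚ ℚ.+ ½ ℚ.* c ℚ.< c
  half-less = subst (0ℚ ℚ.+ ½ ℚ.* c ℚ.<_) (half+half c) (ℚₚ.+-monoˡ-< (½ ℚ.* c) (half-pos c 0<c))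

  bound : ∀ n → N ℕ.≤ n → 0ℚ ℚ.+ ½ ℚ.* c ℚ.< inv (ε ℚ.⊔ seq x n) (clip-pos (seq x n) 0<ε)
  bound n n≥ = ℚₚ.<-≤-trans half-less
    (inv-antimono (ε ℚ.⊔ seq x n) (ε ℚ.⊔ B) (clip-pos (seq x n) 0<ε) (clip-pos B 0<ε)
      (ℚₚ.⊔-monoʳ-≤ ε (ℚₚ.≤-trans (p≤∣p∣ (seq x n)) (∣x∣≤B n n≥))))

product-pos : ∀ x y → 0ℝ < x → 0ℝ < y → 0ℝ < x * y
product-pos x y (ε , 0<ε , M , x>ε) (δ , 0<δ , N , y>δ) =
  ε ℚ.* δ , *-pos 0<ε 0<δ , M ℕ.⊔ N , λ n n≥ →
    let x>   = subst (ℚ._< seq x n) (ℚₚ.+-identityˡ ε) (x>ε n (proj₁ (⊔-≤ M N n≥)))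
        y>   = subst (ℚ._< seq y n) (ℚₚ.+-identityˡ δ) (y>δ n (proj₂ (⊔-≤ M N n≥)))
        0<y  = ℚₚ.<-trans 0<δ y>
    in begin-strict
    0ℚ ℚ.+ ε ℚ.* δ      ≡⟨ ℚₚ.+-identityˡ (ε ℚ.* δ) ⟩
    ε ℚ.* δ             <⟨ ℚₚ.*-monoʳ-<-pos ε {{positive 0<ε}} y> ⟩
    ε ℚ.* seq y n       <⟨ ℚₚ.*-monoˡ-<-pos (seq y n) {{positive 0<y}} x> ⟩
    seq x n ℚ.* seq y n ∎
  where open ℚₚ.≤-Reasoning

infixl 7 _÷_

_÷_ : ℝ⁺ → ℝ⁺ → ℝ⁺
(x ÷ y) .val = val x * recip y
(x ÷ y) .pos = product-pos (val x) (recip y) (pos x) (recip-pos y)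

LogConvex : (ℕ → ℝ⁺) → Set
LogConvex x = ∀ n → val (x (suc n)) ^ 2 ≤ val (x n) * val (x (suc (suc n)))

ratio : (ℕ → ℝ⁺) → ℕ → ℝ⁺
ratio x n = x (suc n) ÷ x n

RatioLogConvex : (ℕ → ℝ⁺) → Set
RatioLogConvex x = LogConvex (ratio x)

-- The sequence {x_n}_{n ≥ N}, reindexed to start at 0.
from : ℕ → (ℕ → ℝ⁺) → ℕ → ℝ⁺
from N x k = x (N ℕ.+ k)

-- Coefficient lists, constant term first.
Poly : Set
Poly = List ℝ

infixl 6 _+ₚ_ _-ₚ_
infixl 7 _*ₚ_
infixr 8 _^ₚ_

C : ℝ → Poly
C c = c ∷ []

X : Poly
X = 0ℝ ∷ 1ℝ ∷ []

_+ₚ_ : Poly → Poly → Poly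
[]      +ₚ q       = q
(c ∷ p) +ₚ []      = c ∷ p
(c ∷ p) +ₚ (d ∷ q) = (c + d) ∷ (p +ₚ q)

_-ₚ_ : Poly → Poly → Poly
p -ₚ q = p +ₚ map -_ q

_*ₚ_ : Poly → Poly → Poly
[]      *ₚ q = []
(c ∷ p) *ₚ q = map (c *_) q +ₚ (0ℝ ∷ p *ₚ q)

_^ₚ_ : Poly → ℕ → Poly
p ^ₚ zero  = C 1ℝ
p ^ₚ suc n = p *ₚ p ^ₚ n

infix 9 _⟨_⟩

_⟨_⟩ : Poly → ℝ → ℝ
[]      ⟨ x ⟩ = 0ℝ
(c ∷ p) ⟨ x ⟩ = c + x * p ⟨ x ⟩

-- k c₀ + (k+1) c₁ X + (k+2) c₂ X² + ⋯
scaleFrom : ℕ → Poly → Poly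
scaleFrom k []      = []
scaleFrom k (c ∷ p) = fromℕ k * c ∷ scaleFrom (suc k) p

derivative : Poly → Poly
derivative []      = []
derivative (_ ∷ p) = scaleFrom 1 p

f : (a b : ℕ → ℝ) → ℕ → Poly
f a b n =
  (C (a (suc n) * a n + b (suc n)) *ₚ X +ₚ C (a (suc n) * b n))
    *ₚ (X -ₚ C (a (n ℕ.∸ 1))) *ₚ X ^ₚ 6
  -ₚ C (b (n ℕ.∸ 1)) *ₚ (C (a n) *ₚ X +ₚ C (b n)) ^ₚ 4

{-# OPTIONS --safe #-}

-- With xₙ = zₙ / zₙ₋₁ the recurrence reads xₙ₊₁ = aₙ + bₙ / xₙ, which expresses xₙ₋₁, xₙ₊₁ and
-- xₙ₊₂ through xₙ and turns the claim xₙ₊₁³ xₙ₋₁ ≤ xₙ³ xₙ₊₂ into fₙ(xₙ) ≥ 0.  Expand fₙ at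
-- λₙ ≤ xₙ to second order: the first three coefficients are nonnegative by hypothesis, and the
-- remainder is nonnegative on [aₙ, ∞) because of the monotonicity of a and b and
-- 21aₙ² + 11aₙ₊₁aₙ − 4bₙ₋₁ ≥ 0.
module Submission where

open import Algebra.Bundles using (CommutativeRing)
open import Algebra.Solver.Ring.AlmostCommutativeRing
  using (_-Raw-AlmostCommutative⟶_; fromCommutativeRing)
import Algebra.Solver.Ring as RingSolver
open import Algebra.Structures using (IsCommutativeRing)
open import Data.Fin.Patterns
open import Data.Integer.Base as ℤ using (+_)
import Data.Integer.Properties as ℤₚ
open import Data.List.Base using ([]; _∷_; map)
import Data.Maybe.Base as Maybe
open import Data.Nat.Base as ℕ using (ℕ; zero; suc)
import Data.Nat.Properties as ℕₚ
open import Data.Product.Base using (_×_; _,_; proj₁; proj₂)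
open import Data.Rational.Base as ℚ using (ℚ; 0ℚ; 1ℚ; ½; ∣_∣)
import Data.Rational.Properties as ℚₚ
open import Data.Rational.Solver using (module +-*-Solver)
import Data.Rational.Unnormalised.Base as ℚᵘ
import Data.Rational.Unnormalised.Properties as ℚᵘₚ
open import Data.Vec.Base using (Vec) renaming ([] to []ᵥ; _∷_ to _∷ᵥ_)
open import Level using (_⊔_) renaming (suc to lsuc)
open import Relation.Binary.PropositionalEquality as ≡ using (_≡_)
open import Relation.Nullary.Decidable using (from-yes)
open import Relation.Nullary.Decidable.Core using (dec⇒maybe)

-- The Taylor expansion is an exact polynomial identity, so no mean value theorem is involved: what
-- remains is ring identities and sums and products of nonnegative elements. The obstacle is that
-- `f` is a coefficient list whose derivatives act on the multiplied-out coefficients. Carrying the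
-- first two derivatives along with each value turns evaluation into a homomorphism for the
-- polynomial operations, so the derivatives of `f` follow from the product rule without expansion.
-- Reals are sequences of rationals with termwise operations, so such an identity holds exactly at
-- each index and can be settled in ℚ.

-- Ordered rings with rational constants.

record OrderedRing c ℓ ℓ′ : Set (lsuc (c ⊔ ℓ ⊔ ℓ′)) where
  field
    commutativeRing : CommutativeRing c ℓ
  open CommutativeRing commutativeRing using (Carrier; _≈_; _+_; _*_)
  field
    ι : ℚₚ.+-*-rawRing -Raw-AlmostCommutative⟶ fromCommutativeRing commutativeRing
  open _-Raw-AlmostCommutative⟶_ ι using (⟦_⟧)
  field
    -- Only a cone of nonnegative elements is asked for, with neither totality nor cancellation, so
    -- that constructive reals qualify.
    0≤_       : Carrier → Set ℓ′
    0≤-resp-≈ : ∀ {x y} → x ≈ y → 0≤ x → 0≤ y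
    0≤-+      : ∀ {x y} → 0≤ x → 0≤ y → 0≤ (x + y)
    0≤-*      : ∀ {x y} → 0≤ x → 0≤ y → 0≤ (x * y)
    0≤-⟦⟧     : ∀ {q} → 0ℚ ℚ.≤ q → 0≤ ⟦ q ⟧

module OrderedRingProperties {c ℓ ℓ′} (O : OrderedRing c ℓ ℓ′) where

  open OrderedRing O
  open CommutativeRing commutativeRing using
    ( Carrier; _≈_; _+_; _*_; 1#; _-_; semiring; setoid; refl; sym; trans; reflexive
    ; +-cong; +-congˡ; +-congʳ; *-cong; *-congˡ; *-congʳ; -‿cong; *-identityˡ)
  open import Algebra.Properties.Semiring.Exp semiring using (_^_; ^-congˡ)
  open import Relation.Binary.Reasoning.Setoid setoid
  open _-Raw-AlmostCommutative⟶_ ι using (⟦_⟧; 1-homo)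
  open RingSolver ℚₚ.+-*-rawRing (fromCommutativeRing commutativeRing) ι
    (λ p q → Maybe.map (λ p≡q → reflexive (≡.cong ⟦_⟧ p≡q)) (dec⇒maybe (p ℚₚ.≟ q)))
    using (Polynomial; solve; con; _:=_; _:+_; _:*_; _:-_; _:^_)

  infix 10 #_
  infix 4 _≼_

  #_ : ℕ → Carrier
  # n = ⟦ + n ℚ./ 1 ⟧

  _≼_ : Carrier → Carrier → Set ℓ′
  x ≼ y = 0≤ (y - x)

  private
    `_ : ∀ {m} → ℕ → Polynomial m
    ` n = con (+ n ℚ./ 1)

  0≤-^ : ∀ {x} → 0≤ x → ∀ n → 0≤ (x ^ n)
  0≤-^ 0≤x zero    = 0≤-resp-≈ 1-homo (0≤-⟦⟧ (from-yes (0ℚ ℚₚ.≤? 1ℚ)))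
  0≤-^ 0≤x (suc n) = 0≤-* 0≤x (0≤-^ 0≤x n)

  0≤-trans : ∀ {x y} → 0≤ x → x ≼ y → 0≤ y
  0≤-trans {x} {y} 0≤x x≼y =
    0≤-resp-≈ (solve 2 (λ x y → x :+ (y :- x) := y) refl x y) (0≤-+ 0≤x x≼y)

  ≼-trans : ∀ {x y z} → x ≼ y → y ≼ z → x ≼ z
  ≼-trans {x} {y} {z} x≼y y≼z =
    0≤-resp-≈ (solve 3 (λ x y z → (y :- x) :+ (z :- y) := z :- x) refl x y z) (0≤-+ x≼y y≼z)

  ^-monoˡ-≼ : ∀ {x y} → 0≤ x → x ≼ y → ∀ n → x ^ n ≼ y ^ n
  ^-monoˡ-≼ {x} {y} 0≤x x≼y zero =
    0≤-resp-≈ (solve 1 (λ u → con 0ℚ := u :- u) refl 1#) (0≤-⟦⟧ ℚₚ.≤-refl)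
  ^-monoˡ-≼ {x} {y} 0≤x x≼y (suc n) = 0≤-resp-≈
    (solve 4 (λ x y u v → y :* (v :- u) :+ (y :- x) :* u := y :* v :- x :* u) refl
      x y (x ^ n) (y ^ n))
    (0≤-+ (0≤-* (0≤-trans 0≤x x≼y) (^-monoˡ-≼ 0≤x x≼y n)) (0≤-* x≼y (0≤-^ 0≤x n)))

  -- Multiplying by a nonnegative inverse stands in for division, as the axioms of `0≤_` contain no
  -- cancellation law.
  0≤-cancelˡ : ∀ {x y x⁻¹} → x * x⁻¹ ≈ 1# → 0≤ x⁻¹ → 0≤ (x * y) → 0≤ y
  0≤-cancelˡ {x} {y} {x⁻¹} inverse 0≤x⁻¹ 0≤xy = 0≤-resp-≈
    (begin
      x⁻¹ * (x * y)   ≈⟨ solve 3 (λ x y i → i :* (x :* y) := (x :* i) :* y) refl x y x⁻¹ ⟩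
      (x * x⁻¹) * y   ≈⟨ *-congʳ inverse ⟩
      1# * y          ≈⟨ *-identityˡ y ⟩
      y               ∎)
    (0≤-* 0≤x⁻¹ 0≤xy)

  ratio-recurrence : ∀ {u v w a b u⁻¹ v⁻¹} → u * u⁻¹ ≈ 1# → v * v⁻¹ ≈ 1# →
                     w ≈ a * v + b * u →
                     b ≈ (w * v⁻¹) * (v * u⁻¹) - a * (v * u⁻¹)
  ratio-recurrence {u} {v} {w} {a} {b} {u⁻¹} {v⁻¹} uu⁻¹≈1 vv⁻¹≈1 w≈ = sym (begin
    (w * v⁻¹) * (v * u⁻¹) - a * (v * u⁻¹)
      ≈⟨ solve 5 (λ v w a i j → (w :* j) :* (v :* i) :- a :* (v :* i) := (w :* i) :* (v :* j) :- a :* (v :* i))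
           refl v w a u⁻¹ v⁻¹ ⟩
    (w * u⁻¹) * (v * v⁻¹) - a * (v * u⁻¹)
      ≈⟨ +-congʳ (*-cong (*-congʳ w≈) vv⁻¹≈1) ⟩
    ((a * v + b * u) * u⁻¹) * 1# - a * (v * u⁻¹)
      -- `1#` is the atom `o` here, since the solver's constants are images of rationals; the next
      -- two steps trade it for `⟦ 1ℚ ⟧`.
      ≈⟨ solve 6 (λ u v a b i o → ((a :* v :+ b :* u) :* i) :* o :- a :* (v :* i)
                                := b :* (u :* i) :* o :+ a :* (v :* i) :* (o :- con 1ℚ))
           refl u v a b u⁻¹ 1# ⟩
    b * (u * u⁻¹) * 1# + a * (v * u⁻¹) * (1# - ⟦ 1ℚ ⟧)
      ≈⟨ +-cong (*-congʳ (*-congˡ uu⁻¹≈1)) (*-congˡ (+-congʳ (sym 1-homo))) ⟩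
    b * 1# * 1# + a * (v * u⁻¹) * (⟦ 1ℚ ⟧ - ⟦ 1ℚ ⟧)
      ≈⟨ +-congʳ (*-cong (*-congˡ (sym 1-homo)) (sym 1-homo)) ⟩
    b * ⟦ 1ℚ ⟧ * ⟦ 1ℚ ⟧ + a * (v * u⁻¹) * (⟦ 1ℚ ⟧ - ⟦ 1ℚ ⟧)
      ≈⟨ solve 4 (λ v a b i → b :* con 1ℚ :* con 1ℚ :+ a :* (v :* i) :* (con 1ℚ :- con 1ℚ) := b)
           refl v a b u⁻¹ ⟩
    b ∎)

  -- The polynomial of the theorem and the sign of its cubic remainder.

  -- a′, a, c stand for aₙ₊₁, aₙ, aₙ₋₁, and b′, b, d for bₙ₊₁, bₙ, bₙ₋₁.
  F : (a a′ b b′ c d x : Carrier) → Carrier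
  F a a′ b b′ c d x =
    ((a′ * a + b′) * x + a′ * b) * (x - c) * x ^ 6 - d * (a * x + b) ^ 4

  F-cong : ∀ {a a′ b₁ b₂ b′₁ b′₂ c d₁ d₂ x} → b₁ ≈ b₂ → b′₁ ≈ b′₂ → d₁ ≈ d₂ →
           F a a′ b₁ b′₁ c d₁ x ≈ F a a′ b₂ b′₂ c d₂ x
  F-cong b≈ b′≈ d≈ = +-cong
    (*-congʳ (*-congʳ (+-cong (*-congʳ (+-congˡ b′≈)) (*-congˡ b≈))))
    (-‿cong (*-cong d≈ (^-congˡ 4 (+-congˡ b≈))))

  -- Quotients by (x − l)³ of the second-order Taylor remainders at l of x⁶, x⁷ and F.
  rem₆ rem₇ : (l x : Carrier) → Carrier
  rem₆ l x = x ^ 3 + # 3 * x ^ 2 * l + # 6 * x * l ^ 2 + # 10 * l ^ 3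
  rem₇ l x = x * rem₆ l x + # 15 * l ^ 4

  rem-F : (a a′ b b′ c d l x : Carrier) → Carrier
  rem-F a a′ b b′ c d l x =
    (a′ * a + b′) * ((x - c) * rem₇ l x + # 21 * l ^ 5)
    + a′ * b * ((x - c) * rem₆ l x + # 15 * l ^ 4)
    - d * (a ^ 3 * (# 3 * (a * l + b) + (a * x + b)))

  -- At `x = l`, apart from the nonnegative terms with factor `l − c`, there remains 21Al⁵ + 15a′bl⁴
  -- - 4da³(al + b), where A = a′a + b′ ≥ b. Of the 15 copies of a′bl⁴, 4 absorb 4da⁴l, because d ≤
  -- b and a ≤ a′, a ≤ l. The other 11 together with 21bl⁵ leave at least ba³(21a² + 11a′a - 4d),
  -- which is the source of the hypothesis. The numbers 21 and 15 are the binomials (7 choose 2) and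
  -- (6 choose 2) of the quadratic Taylor terms of x⁷ and x⁶.
  rem-F-nonneg : ∀ {a a′ b b′ c d l x} →
    0≤ a → 0≤ d → c ≼ a → a ≼ a′ → d ≼ b → b ≼ b′ → a ≼ l → l ≼ x →
    0≤ (# 21 * a ^ 2 + # 11 * a′ * a - # 4 * d) →
    0≤ rem-F a a′ b b′ c d l x
  rem-F-nonneg {a} {a′} {b} {b′} {c} {d} {l} {x} 0≤a 0≤d c≼a a≼a′ d≼b b≼b′ a≼l l≼x disc =
    0≤-resp-≈
      (solve 8 (λ a a′ b b′ c d l x →
        let A  = a′ :* a :+ b′
            t  = x :- l
            r₆ = x :^ 3 :+ ` 3 :* x :^ 2 :* l :+ ` 6 :* x :* l :^ 2 :+ ` 10 :* l :^ 3
            r₇ = x :* r₆ :+ ` 15 :* l :^ 4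
        in  A :* (l :- c) :* r₇
            -- Moving from `l` to `x` increases the subtracted part by da⁴t. One of the 15 copies of
            -- Atl⁴ pays for it in the next summand; 14 stay here.
            :+ A :* t :* (x :* r₆ :+ ` 14 :* l :^ 4)
            :+ t :* ((a′ :* a :+ (b′ :- d)) :* l :^ 4 :+ d :* (l :^ 4 :- a :^ 4))
            :+ a′ :* b :* ((x :- c) :* r₆)
            :+ ` 21 :* (a′ :* a :+ (b′ :- b)) :* l :^ 5
            :+ b :* (` 21 :* (l :^ 5 :- a :^ 5) :+ ` 11 :* a′ :* (l :^ 4 :- a :^ 4)
                     :+ a :^ 3 :* (` 21 :* a :^ 2 :+ ` 11 :* a′ :* a :- ` 4 :* d))
            :+ ` 4 :* l :* (a′ :* b :* (l :^ 3 :- a :^ 3)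
                            :+ a :^ 3 :* ((a′ :- a) :* b :+ a :* (b :- d)))
        :=  A :* ((x :- c) :* r₇ :+ ` 21 :* l :^ 5)
            :+ a′ :* b :* ((x :- c) :* r₆ :+ ` 15 :* l :^ 4)
            :- d :* (a :^ 3 :* (` 3 :* (a :* l :+ b) :+ (a :* x :+ b))))
        refl a a′ b b′ c d l x)
      (0≤-* (0≤-* 0≤A (≼-trans c≼a a≼l)) 0≤rem₇
       ⊕ 0≤-* (0≤-* 0≤A l≼x) (0≤-* 0≤x 0≤rem₆ ⊕ 0≤-* (0≤-# 14) (0≤-^ 0≤l 4))
       ⊕ 0≤-* l≼x (0≤-* (0≤-* 0≤a′ 0≤a ⊕ ≼-trans d≼b b≼b′) (0≤-^ 0≤l 4)
                   ⊕ 0≤-* 0≤d (^-monoˡ-≼ 0≤a a≼l 4))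
       ⊕ 0≤-* (0≤-* 0≤a′ 0≤b) (0≤-* (≼-trans c≼a (≼-trans a≼l l≼x)) 0≤rem₆)
       ⊕ 0≤-* (0≤-* (0≤-# 21) (0≤-* 0≤a′ 0≤a ⊕ b≼b′)) (0≤-^ 0≤l 5)
       ⊕ 0≤-* 0≤b (0≤-* (0≤-# 21) (^-monoˡ-≼ 0≤a a≼l 5)
                   ⊕ 0≤-* (0≤-* (0≤-# 11) 0≤a′) (^-monoˡ-≼ 0≤a a≼l 4)
                   ⊕ 0≤-* (0≤-^ 0≤a 3) disc)
       ⊕ 0≤-* (0≤-* (0≤-# 4) 0≤l)
              (0≤-* (0≤-* 0≤a′ 0≤b) (^-monoˡ-≼ 0≤a a≼l 3)
               ⊕ 0≤-* (0≤-^ 0≤a 3) (0≤-* a≼a′ 0≤b ⊕ 0≤-* 0≤a d≼b)))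
    where
    infixl 6 _⊕_
    _⊕_ : ∀ {x y} → 0≤ x → 0≤ y → 0≤ (x + y)
    _⊕_ = 0≤-+

    0≤-# : ∀ n → 0≤ (# n)
    0≤-# n = 0≤-⟦⟧ (ℚₚ.nonNegative⁻¹ (+ n ℚ./ 1) {{ℚₚ.normalize-nonNeg n 1}})

    0≤a′ = 0≤-trans 0≤a a≼a′
    0≤b  = 0≤-trans 0≤d d≼b
    0≤l  = 0≤-trans 0≤a a≼l
    0≤x  = 0≤-trans 0≤l l≼x
    0≤A  = 0≤-* 0≤a′ 0≤a ⊕ 0≤-trans 0≤b b≼b′

    0≤rem₆ : 0≤ rem₆ l x
    0≤rem₆ = 0≤-^ 0≤x 3 ⊕ 0≤-* (0≤-* (0≤-# 3) (0≤-^ 0≤x 2)) 0≤l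
             ⊕ 0≤-* (0≤-* (0≤-# 6) 0≤x) (0≤-^ 0≤l 2) ⊕ 0≤-* (0≤-# 10) (0≤-^ 0≤l 3)

    0≤rem₇ : 0≤ rem₇ l x
    0≤rem₇ = 0≤-* 0≤x 0≤rem₆ ⊕ 0≤-* (0≤-# 15) (0≤-^ 0≤l 4)

  -- The expansion is doubled so that the second derivative `y₂` appears undivided; `½` is applied
  -- once, to the finished nonnegative sum.
  taylor-nonneg : ∀ {y y₀ y₁ y₂ t r} →
    # 2 * y ≈ # 2 * y₀ + # 2 * y₁ * t + y₂ * t ^ 2 + # 2 * t ^ 3 * r →
    0≤ y₀ → 0≤ y₁ → 0≤ y₂ → 0≤ t → 0≤ r → 0≤ y
  taylor-nonneg {y} expansion 0≤y₀ 0≤y₁ 0≤y₂ 0≤t 0≤r = 0≤-resp-≈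
    (trans (*-congˡ (sym expansion))
      (solve 1 (λ y → con ½ :* (` 2 :* y) := y) refl y))
    (0≤-* (0≤-⟦⟧ (from-yes (0ℚ ℚₚ.≤? ½)))
      (0≤-+ (0≤-+ (0≤-+ (0≤-* 0≤2 0≤y₀) (0≤-* (0≤-* 0≤2 0≤y₁) 0≤t))
                  (0≤-* 0≤y₂ (0≤-^ 0≤t 2)))
            (0≤-* (0≤-* 0≤2 (0≤-^ 0≤t 3)) 0≤r)))
    where
    0≤2 : 0≤ (# 2)
    0≤2 = 0≤-⟦⟧ (from-yes (0ℚ ℚₚ.≤? (+ 2 ℚ./ 1)))

  -- By the recurrences, y₀ F(y₁) = d y₁⁴ y₂ (y₁³ y₃ − y₂³ y₀).
  F-nonneg⇒cubes : ∀ {a a′ b b′ c d y₀ y₁ y₂ y₃ d⁻¹ y₁⁻¹ y₂⁻¹} →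
    d ≈ y₁ * y₀ - c * y₀ → b ≈ y₂ * y₁ - a * y₁ → b′ ≈ y₃ * y₂ - a′ * y₂ →
    d * d⁻¹ ≈ 1# → y₁ * y₁⁻¹ ≈ 1# → y₂ * y₂⁻¹ ≈ 1# →
    0≤ d⁻¹ → 0≤ y₁⁻¹ → 0≤ y₂⁻¹ → 0≤ y₀ →
    0≤ F a a′ b b′ c d y₁ →
    y₂ ^ 3 * y₀ ≼ y₁ ^ 3 * y₃
  F-nonneg⇒cubes {a} {a′} {b} {b′} {c} {d} {y₀} {y₁} {y₂} {y₃}
    d≈ b≈ b′≈ dd⁻¹≈1 y₁y₁⁻¹≈1 y₂y₂⁻¹≈1 0≤d⁻¹ 0≤y₁⁻¹ 0≤y₂⁻¹ 0≤y₀ 0≤F =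
    0≤-cancelˡ y₂y₂⁻¹≈1 0≤y₂⁻¹
      (cancel-y₁ (cancel-y₁ (cancel-y₁ (cancel-y₁
        (0≤-cancelˡ dd⁻¹≈1 0≤d⁻¹ (0≤-resp-≈ y₀F≈ (0≤-* 0≤y₀ 0≤F)))))))
    where
    Δ = y₁ ^ 3 * y₃ - y₂ ^ 3 * y₀

    cancel-y₁ : ∀ {x} → 0≤ (y₁ * x) → 0≤ x
    cancel-y₁ = 0≤-cancelˡ y₁y₁⁻¹≈1 0≤y₁⁻¹

    y₀F≈ : y₀ * F a a′ b b′ c d y₁ ≈ d * (y₁ * (y₁ * (y₁ * (y₁ * (y₂ * Δ)))))
    y₀F≈ = begin
      y₀ * F a a′ b b′ c d y₁
        ≈⟨ *-congˡ (F-cong b≈ b′≈ d≈) ⟩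
      y₀ * F a a′ (y₂ * y₁ - a * y₁) (y₃ * y₂ - a′ * y₂) c (y₁ * y₀ - c * y₀) y₁
        -- The factors of `F` become monomials up to `d`: y₀(y₁ - c) = d, ay₁ + b = y₁y₂, and (a′a +
        -- b′)y₁ + a′b = a′(ay₁ + b) + b′y₁ = y₁y₂y₃.
        ≈⟨ solve 7 (λ a a′ c y₀ y₁ y₂ y₃ →
             let b  = y₂ :* y₁ :- a :* y₁
                 b′ = y₃ :* y₂ :- a′ :* y₂
                 d  = y₁ :* y₀ :- c :* y₀
             in  y₀ :* (((a′ :* a :+ b′) :* y₁ :+ a′ :* b) :* (y₁ :- c) :* y₁ :^ 6
                        :- d :* (a :* y₁ :+ b) :^ 4)
             :=  d :* (y₁ :* (y₁ :* (y₁ :* (y₁ :* (y₂ :* (y₁ :^ 3 :* y₃ :- y₂ :^ 3 :* y₀)))))))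
             refl a a′ c y₀ y₁ y₂ y₃ ⟩
      (y₁ * y₀ - c * y₀) * (y₁ * (y₁ * (y₁ * (y₁ * (y₂ * Δ)))))
        ≈⟨ *-congʳ (sym d≈) ⟩
      d * (y₁ * (y₁ * (y₁ * (y₁ * (y₂ * Δ))))) ∎

  -- Division by y₀y₁²y₂ turns y₁³y₃ into (y₁/y₀)(y₃/y₂) and y₂³y₀ into (y₂/y₁)².
  cubes⇒ratios : ∀ {y₀ y₁ y₂ y₃ y₀⁻¹ y₁⁻¹ y₂⁻¹} →
    y₀ * y₀⁻¹ ≈ 1# → y₁ * y₁⁻¹ ≈ 1# → y₂ * y₂⁻¹ ≈ 1# →
    0≤ y₀⁻¹ → 0≤ y₁⁻¹ → 0≤ y₂⁻¹ →
    y₂ ^ 3 * y₀ ≼ y₁ ^ 3 * y₃ →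
    (y₂ * y₁⁻¹) ^ 2 ≼ (y₁ * y₀⁻¹) * (y₃ * y₂⁻¹)
  cubes⇒ratios {y₀} {y₁} {y₂} {y₃} {i} {j} {k} y₀i≈1 y₁j≈1 y₂k≈1 0≤i 0≤j 0≤k cubes = 0≤-resp-≈
    (begin
      (i * j ^ 2 * k) * (y₁ ^ 3 * y₃ - y₂ ^ 3 * y₀)
        ≈⟨ solve 7 (λ y₀ y₁ y₂ y₃ i j k →
             (i :* j :^ 2 :* k) :* (y₁ :^ 3 :* y₃ :- y₂ :^ 3 :* y₀) :=
             (y₁ :* j) :^ 2 :* ((y₁ :* i) :* (y₃ :* k))
             :- (y₂ :* k) :* (y₀ :* i) :* (y₂ :* j) :^ 2) refl y₀ y₁ y₂ y₃ i j k ⟩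
      (y₁ * j) ^ 2 * ((y₁ * i) * (y₃ * k)) - (y₂ * k) * (y₀ * i) * (y₂ * j) ^ 2
        ≈⟨ +-cong (*-congʳ (^-congˡ 2 (to-⟦1⟧ y₁j≈1)))
             (-‿cong (*-congʳ (*-cong (to-⟦1⟧ y₂k≈1) (to-⟦1⟧ y₀i≈1)))) ⟩
      ⟦ 1ℚ ⟧ ^ 2 * ((y₁ * i) * (y₃ * k)) - ⟦ 1ℚ ⟧ * ⟦ 1ℚ ⟧ * (y₂ * j) ^ 2
        ≈⟨ solve 2 (λ u v → con 1ℚ :^ 2 :* u :- con 1ℚ :* con 1ℚ :* v :^ 2 := u :- v :^ 2) refl
             ((y₁ * i) * (y₃ * k)) (y₂ * j) ⟩
      (y₁ * i) * (y₃ * k) - (y₂ * j) ^ 2 ∎)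
    (0≤-* (0≤-* (0≤-* 0≤i (0≤-^ 0≤j 2)) 0≤k) cubes)
    where
    to-⟦1⟧ : ∀ {x} → x ≈ 1# → x ≈ ⟦ 1ℚ ⟧
    to-⟦1⟧ x≈1 = trans x≈1 (sym 1-homo)

open import Defs

-- The Cauchy reals as an ordered ring.

-- Reduces each ring law for reals to the same law in ℚ, since the operations act termwise; only the
-- equivalence and congruence laws need an ε-argument.
pointwise : ∀ {x y} → (∀ n → seq x n ≡ seq y n) → x ≈ y
pointwise {x} {y} x≡y ε 0<ε = 0 , λ n _ →
  ≡.subst (λ p → ∣ p ∣ ℚ.< ε)
    (≡.sym (≡.trans (≡.cong (ℚ._- seq y n) (x≡y n)) (ℚₚ.+-inverseʳ (seq y n)))) 0<ε

≈-sym : ∀ {x y} → x ≈ y → y ≈ x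
≈-sym {x} {y} x≈y ε 0<ε =
  let N , close = x≈y ε 0<ε in N , λ n n≥ →
  ≡.subst (ℚ._< ε)
    (≡.trans (≡.sym (ℚₚ.∣-p∣≡∣p∣ (seq x n ℚ.- seq y n)))
      (≡.cong ∣_∣ (solve 2 (λ x y → :- (x :- y) := y :- x) ≡.refl (seq x n) (seq y n))))
    (close n n≥)
  where open +-*-Solver

≈-trans : ∀ {x y z} → x ≈ y → y ≈ z → x ≈ z
≈-trans {x} {y} {z} x≈y y≈z ε 0<ε =
  let M , x-close = x≈y (½ ℚ.* ε) (half-pos ε 0<ε)
      N , y-close = y≈z (½ ℚ.* ε) (half-pos ε 0<ε)
  in M ℕ.⊔ N , λ n n≥ → ≡.subst (λ p → ∣ p ∣ ℚ.< ε)
    (solve 3 (λ x y z → (x :- y) :+ (y :- z) := x :- z) ≡.refl (seq x n) (seq y n) (seq z n))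
    (+-estimate (seq x n ℚ.- seq y n) (seq y n ℚ.- seq z n) ε
      (x-close n (proj₁ (⊔-≤ M N n≥))) (y-close n (proj₂ (⊔-≤ M N n≥))))
  where open +-*-Solver

+-cong : ∀ {x x′ y y′} → x ≈ x′ → y ≈ y′ → x + y ≈ x′ + y′
+-cong {x} {x′} {y} {y′} x≈x′ y≈y′ ε 0<ε =
  let M , x-close = x≈x′ (½ ℚ.* ε) (half-pos ε 0<ε)
      N , y-close = y≈y′ (½ ℚ.* ε) (half-pos ε 0<ε)
  in M ℕ.⊔ N , λ n n≥ → ≡.subst (λ p → ∣ p ∣ ℚ.< ε)
    (solve 4 (λ x x′ y y′ → (x :- x′) :+ (y :- y′) := (x :+ y) :- (x′ :+ y′)) ≡.refl
      (seq x n) (seq x′ n) (seq y n) (seq y′ n))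
    (+-estimate (seq x n ℚ.- seq x′ n) (seq y n ℚ.- seq y′ n) ε
      (x-close n (proj₁ (⊔-≤ M N n≥))) (y-close n (proj₂ (⊔-≤ M N n≥))))
  where open +-*-Solver

-‿cong : ∀ {x y} → x ≈ y → - x ≈ - y
-‿cong {x} {y} x≈y ε 0<ε =
  let N , close = ≈-sym {x} {y} x≈y ε 0<ε in N , λ n n≥ →
  ≡.subst (λ p → ∣ p ∣ ℚ.< ε)
    (solve 2 (λ x y → y :- x := (:- x) :- (:- y)) ≡.refl (seq x n) (seq y n)) (close n n≥)
  where open +-*-Solver

*-congˡ : ∀ x {y z} → y ≈ z → x * y ≈ x * z
*-congˡ x {y} {z} y≈z ε 0<ε =
  let B , 0<B , M , ∣x∣≤B = eventually-bounded x
      N , close = y≈z (ε ℚ.* inv B 0<B) (*-pos 0<ε (inv-pos B 0<B))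
  in M ℕ.⊔ N , λ n n≥ → ≡.subst₂ ℚ._<_
    (≡.cong ∣_∣ (solve 3 (λ x y z → x :* (y :- z) := x :* y :- x :* z) ≡.refl
      (seq x n) (seq y n) (seq z n)))
    (*-cancel-inv B 0<B ε)
    (*-estimate (seq x n) (seq y n ℚ.- seq z n) (∣x∣≤B n (proj₁ (⊔-≤ M N n≥))) 0<B
      (close n (proj₂ (⊔-≤ M N n≥))))
  where open +-*-Solver

*-comm : ∀ x y → x * y ≈ y * x
*-comm x y = pointwise {x * y} {y * x} λ n → ℚₚ.*-comm (seq x n) (seq y n)

*-cong : ∀ {x x′ y y′} → x ≈ x′ → y ≈ y′ → x * y ≈ x′ * y′
*-cong {x} {x′} {y} {y′} x≈x′ y≈y′ =
  ≈-trans {x * y} {x * y′} {x′ * y′} (*-congˡ x {y} {y′} y≈y′)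
    (≈-trans {x * y′} {y′ * x} {x′ * y′} (*-comm x y′)
      (≈-trans {y′ * x} {y′ * x′} {x′ * y′} (*-congˡ y′ {x} {x′} x≈x′) (*-comm y′ x′)))

+-*-isCommutativeRing : IsCommutativeRing _≈_ _+_ _*_ -_ 0ℝ 1ℝ
+-*-isCommutativeRing = record
  { isRing = record
    { +-isAbelianGroup = record
      { isGroup = record
        { isMonoid = record
          { isSemigroup = record
            { isMagma = record
              { isEquivalence = record
                { refl  = λ {x} → pointwise {x} {x} λ _ → ≡.refl
                ; sym   = λ {x} {y} → ≈-sym {x} {y}
                ; trans = λ {x} {y} {z} → ≈-trans {x} {y} {z}
                }
              ; ∙-cong = λ {x} {x′} {y} {y′} → +-cong {x} {x′} {y} {y′}
              }
            ; assoc = λ x y z → pointwise {(x + y) + z} {x + (y + z)} λ n →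
                ℚₚ.+-assoc (seq x n) (seq y n) (seq z n)
            }
          ; identity =
              (λ x → pointwise {0ℝ + x} {x} λ n → ℚₚ.+-identityˡ (seq x n)) ,
              (λ x → pointwise {x + 0ℝ} {x} λ n → ℚₚ.+-identityʳ (seq x n))
          }
        ; inverse =
            (λ x → pointwise {(- x) + x} {0ℝ} λ n → ℚₚ.+-inverseˡ (seq x n)) ,
            (λ x → pointwise {x - x} {0ℝ} λ n → ℚₚ.+-inverseʳ (seq x n))
        ; ⁻¹-cong = λ {x} {y} → -‿cong {x} {y}
        }
      ; comm = λ x y → pointwise {x + y} {y + x} λ n → ℚₚ.+-comm (seq x n) (seq y n)
      }
    ; *-cong = λ {x} {x′} {y} {y′} → *-cong {x} {x′} {y} {y′}
    ; *-assoc = λ x y z → pointwise {(x * y) * z} {x * (y * z)} λ n →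
        ℚₚ.*-assoc (seq x n) (seq y n) (seq z n)
    ; *-identity =
        (λ x → pointwise {1ℝ * x} {x} λ n → ℚₚ.*-identityˡ (seq x n)) ,
        (λ x → pointwise {x * 1ℝ} {x} λ n → ℚₚ.*-identityʳ (seq x n))
    ; distrib =
        (λ x y z → pointwise {x * (y + z)} {x * y + x * z} λ n →
          ℚₚ.*-distribˡ-+ (seq x n) (seq y n) (seq z n)) ,
        (λ x y z → pointwise {(y + z) * x} {y * x + z * x} λ n →
          ℚₚ.*-distribʳ-+ (seq x n) (seq y n) (seq z n))
    }
  ; *-comm = *-comm
  }

+-*-commutativeRing : CommutativeRing _ _
+-*-commutativeRing = record { isCommutativeRing = +-*-isCommutativeRing }

fromℚ-homomorphism : ℚₚ.+-*-rawRing -Raw-AlmostCommutative⟶ fromCommutativeRing +-*-commutativeRing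
fromℚ-homomorphism = record
  { ⟦_⟧    = fromℚ
  ; +-homo = λ p q → pointwise {fromℚ (p ℚ.+ q)} {fromℚ p + fromℚ q} λ _ → ≡.refl
  ; *-homo = λ p q → pointwise {fromℚ (p ℚ.* q)} {fromℚ p * fromℚ q} λ _ → ≡.refl
  ; -‿homo = λ p → pointwise {fromℚ (ℚ.- p)} { - fromℚ p} λ _ → ≡.refl
  ; 0-homo = pointwise {0ℝ} {0ℝ} λ _ → ≡.refl
  ; 1-homo = pointwise {1ℝ} {1ℝ} λ _ → ≡.refl
  }

0≤-fromℚ : ∀ {q} → 0ℚ ℚ.≤ q → 0ℝ ≤ fromℚ q
0≤-fromℚ {q} 0≤q ε 0<ε = 0 , λ _ _ →
  ℚₚ.≤-trans 0≤q (≡.subst (ℚ._≤ q ℚ.+ ε) (ℚₚ.+-identityʳ q) (ℚₚ.+-monoʳ-≤ q (ℚₚ.<⇒≤ 0<ε)))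

≤-respʳ-≈ : ∀ {x y z} → y ≈ z → x ≤ y → x ≤ z
≤-respʳ-≈ {x} {y} {z} y≈z x≤y ε 0<ε =
  let M , y-close = y≈z (½ ℚ.* ε) (half-pos ε 0<ε)
      N , x-below = x≤y (½ ℚ.* ε) (half-pos ε 0<ε)
  in M ℕ.⊔ N , λ n n≥ → begin
    seq x n
      ≤⟨ x-below n (proj₂ (⊔-≤ M N n≥)) ⟩
    seq y n ℚ.+ ½ ℚ.* ε
      ≡⟨ solve 3 (λ y z e → y :+ e := (z :+ (y :- z)) :+ e) ≡.refl (seq y n) (seq z n) (½ ℚ.* ε) ⟩
    (seq z n ℚ.+ (seq y n ℚ.- seq z n)) ℚ.+ ½ ℚ.* ε
      ≤⟨ ℚₚ.+-monoˡ-≤ (½ ℚ.* ε) (ℚₚ.+-monoʳ-≤ (seq z n)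
           (ℚₚ.≤-trans (p≤∣p∣ (seq y n ℚ.- seq z n)) (ℚₚ.<⇒≤ (y-close n (proj₁ (⊔-≤ M N n≥)))))) ⟩
    (seq z n ℚ.+ ½ ℚ.* ε) ℚ.+ ½ ℚ.* ε
      ≡⟨ ≡.trans (ℚₚ.+-assoc (seq z n) (½ ℚ.* ε) (½ ℚ.* ε)) (≡.cong (seq z n ℚ.+_) (half+half ε)) ⟩
    seq z n ℚ.+ ε ∎
  where
  open ℚₚ.≤-Reasoning
  open +-*-Solver

0≤-+ : ∀ {x y} → 0ℝ ≤ x → 0ℝ ≤ y → 0ℝ ≤ x + y
0≤-+ {x} {y} 0≤x 0≤y ε 0<ε =
  let M , x-bound = 0≤x (½ ℚ.* ε) (half-pos ε 0<ε)
      N , y-bound = 0≤y (½ ℚ.* ε) (half-pos ε 0<ε)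
  in M ℕ.⊔ N , λ n n≥ → ≡.subst₂ ℚ._≤_ (ℚₚ.+-identityˡ 0ℚ)
    (≡.trans
      (solve 3 (λ x y e → (x :+ e) :+ (y :+ e) := (x :+ y) :+ (e :+ e)) ≡.refl
        (seq x n) (seq y n) (½ ℚ.* ε))
      (≡.cong (seq x n ℚ.+ seq y n ℚ.+_) (half+half ε)))
    (ℚₚ.+-mono-≤ (x-bound n (proj₁ (⊔-≤ M N n≥))) (y-bound n (proj₂ (⊔-≤ M N n≥))))
  where open +-*-Solver

-- With δ = ε / 2B and η = ε / 2(A + δ), where x ≤ A and y ≤ B eventually,
-- 0 ≤ (x + δ)(y + η) = xy + δy + η(x + δ) ≤ xy + ε.
0≤-* : ∀ {x y} → 0ℝ ≤ x → 0ℝ ≤ y → 0ℝ ≤ x * y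
0≤-* {x} {y} 0≤x 0≤y ε 0<ε = (K ℕ.⊔ L) ℕ.⊔ (M ℕ.⊔ N) , bound
  where
  open ℚₚ.≤-Reasoning
  open +-*-Solver using (solve; _:=_; _:+_; _:*_)

  A = proj₁ (eventually-bounded x)
  B = proj₁ (eventually-bounded y)
  0<A = proj₁ (proj₂ (eventually-bounded x))
  0<B = proj₁ (proj₂ (eventually-bounded y))
  K = proj₁ (proj₂ (proj₂ (eventually-bounded x)))
  L = proj₁ (proj₂ (proj₂ (eventually-bounded y)))
  ∣x∣≤A = proj₂ (proj₂ (proj₂ (eventually-bounded x)))
  ∣y∣≤B = proj₂ (proj₂ (proj₂ (eventually-bounded y)))

  δ = ½ ℚ.* ε ℚ.* inv B 0<B
  0<δ : 0ℚ ℚ.< δ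
  0<δ = *-pos (half-pos ε 0<ε) (inv-pos B 0<B)

  0<A+δ : 0ℚ ℚ.< A ℚ.+ δ
  0<A+δ = ≡.subst (ℚ._< A ℚ.+ δ) (ℚₚ.+-identityˡ 0ℚ) (ℚₚ.+-mono-< 0<A 0<δ)

  η = ½ ℚ.* ε ℚ.* inv (A ℚ.+ δ) 0<A+δ
  0<η : 0ℚ ℚ.< η
  0<η = *-pos (half-pos ε 0<ε) (inv-pos (A ℚ.+ δ) 0<A+δ)

  M = proj₁ (0≤x δ 0<δ)
  N = proj₁ (0≤y η 0<η)

  bound : ∀ n → (K ℕ.⊔ L) ℕ.⊔ (M ℕ.⊔ N) ℕ.≤ n → 0ℚ ℚ.≤ seq x n ℚ.* seq y n ℚ.+ ε
  bound n n≥ = begin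
    0ℚ
      ≡⟨ ≡.sym (ℚₚ.*-zeroʳ (p ℚ.+ δ)) ⟩
    (p ℚ.+ δ) ℚ.* 0ℚ
      ≤⟨ ℚₚ.*-monoˡ-≤-nonNeg (p ℚ.+ δ) {{ℚ.nonNegative (proj₂ (0≤x δ 0<δ) n (proj₁ (⊔-≤ M N n≥MN)))}}
           (proj₂ (0≤y η 0<η) n (proj₂ (⊔-≤ M N n≥MN))) ⟩
    (p ℚ.+ δ) ℚ.* (q ℚ.+ η)
      ≡⟨ solve 4 (λ p q d e → (p :+ d) :* (q :+ e) := p :* q :+ (q :* d :+ (p :+ d) :* e)) ≡.refl p q δ η ⟩
    p ℚ.* q ℚ.+ (q ℚ.* δ ℚ.+ (p ℚ.+ δ) ℚ.* η)
      ≤⟨ ℚₚ.+-monoʳ-≤ (p ℚ.* q) (ℚₚ.+-mono-≤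
           (ℚₚ.*-monoʳ-≤-nonNeg δ {{ℚ.nonNegative (ℚₚ.<⇒≤ 0<δ)}}
             (ℚₚ.≤-trans (p≤∣p∣ q) (∣y∣≤B n (proj₂ (⊔-≤ K L n≥KL)))))
           (ℚₚ.*-monoʳ-≤-nonNeg η {{ℚ.nonNegative (ℚₚ.<⇒≤ 0<η)}}
             (ℚₚ.+-monoˡ-≤ δ (ℚₚ.≤-trans (p≤∣p∣ p) (∣x∣≤A n (proj₁ (⊔-≤ K L n≥KL))))))) ⟩
    p ℚ.* q ℚ.+ (B ℚ.* δ ℚ.+ (A ℚ.+ δ) ℚ.* η)
      ≡⟨ ≡.cong (p ℚ.* q ℚ.+_) (≡.trans
           (≡.cong₂ ℚ._+_ (*-cancel-inv B 0<B (½ ℚ.* ε)) (*-cancel-inv (A ℚ.+ δ) 0<A+δ (½ ℚ.* ε)))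
           (half+half ε)) ⟩
    p ℚ.* q ℚ.+ ε ∎
    where
    p = seq x n
    q = seq y n
    n≥KL = proj₁ (⊔-≤ (K ℕ.⊔ L) (M ℕ.⊔ N) n≥)
    n≥MN = proj₂ (⊔-≤ (K ℕ.⊔ L) (M ℕ.⊔ N) n≥)

<⇒≤ : ∀ {x y} → x < y → x ≤ y
<⇒≤ {x} {y} (ε , 0<ε , N , x+ε<y) δ 0<δ = N , λ n n≥ → begin
  seq x n           ≡⟨ ≡.sym (ℚₚ.+-identityʳ (seq x n)) ⟩
  seq x n ℚ.+ 0ℚ    ≤⟨ ℚₚ.+-monoʳ-≤ (seq x n) (ℚₚ.<⇒≤ 0<ε) ⟩
  seq x n ℚ.+ ε     ≤⟨ ℚₚ.<⇒≤ (x+ε<y n n≥) ⟩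
  seq y n           ≡⟨ ≡.sym (ℚₚ.+-identityʳ (seq y n)) ⟩
  seq y n ℚ.+ 0ℚ    ≤⟨ ℚₚ.+-monoʳ-≤ (seq y n) (ℚₚ.<⇒≤ 0<δ) ⟩
  seq y n ℚ.+ δ     ∎
  where open ℚₚ.≤-Reasoning

x≤y⇒0≤y-x : ∀ {x y} → x ≤ y → 0ℝ ≤ y - x
x≤y⇒0≤y-x {x} {y} x≤y ε 0<ε =
  let N , x-below = x≤y ε 0<ε in N , λ n n≥ → ≡.subst₂ ℚ._≤_
    (ℚₚ.+-inverseʳ (seq x n))
    (solve 3 (λ x y e → (y :+ e) :- x := (y :- x) :+ e) ≡.refl (seq x n) (seq y n) ε)
    (ℚₚ.+-monoˡ-≤ (ℚ.- seq x n) (x-below n n≥))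
  where open +-*-Solver

0≤y-x⇒x≤y : ∀ {x y} → 0ℝ ≤ y - x → x ≤ y
0≤y-x⇒x≤y {x} {y} 0≤y-x ε 0<ε =
  let N , bound = 0≤y-x ε 0<ε in N , λ n n≥ → ≡.subst₂ ℚ._≤_
    (ℚₚ.+-identityʳ (seq x n))
    (solve 3 (λ x y e → x :+ ((y :- x) :+ e) := y :+ e) ≡.refl (seq x n) (seq y n) ε)
    (ℚₚ.+-monoʳ-≤ (seq x n) (bound n n≥))
  where open +-*-Solver

-- From the index `N` that witnesses positivity onwards, the clipping in `recip` changes nothing, so
-- the product is exactly 1 there.
recip-inverseʳ : ∀ x → val x * recip x ≈ 1ℝ
recip-inverseʳ (mkℝ⁺ x (ε , 0<ε , N , ε<x)) δ 0<δ = N , λ n n≥ →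
  let q     = seq x n
      u     = ε ℚ.⊔ q
      0<u   = clip-pos q 0<ε
      u≡q   = ℚₚ.p≤q⇒p⊔q≡q (ℚₚ.<⇒≤ (≡.subst (ℚ._< q) (ℚₚ.+-identityˡ ε) (ε<x n n≥)))
      q/u≡1 = ≡.trans (≡.cong (ℚ._* inv u 0<u) (≡.sym u≡q)) (inv-inverseʳ u 0<u)
  in ≡.subst (λ p → ∣ p ℚ.- 1ℚ ∣ ℚ.< δ) (≡.sym q/u≡1) 0<δ

ℝ-orderedRing : OrderedRing _ _ _
ℝ-orderedRing = record
  { commutativeRing = +-*-commutativeRing
  ; ι               = fromℚ-homomorphism
  ; 0≤_             = 0ℝ ≤_
  ; 0≤-resp-≈       = λ {x} {y} → ≤-respʳ-≈ {0ℝ} {x} {y}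
  ; 0≤-+            = λ {x} {y} → 0≤-+ {x} {y}
  ; 0≤-*            = λ {x} {y} → 0≤-* {x} {y}
  ; 0≤-⟦⟧           = 0≤-fromℚ
  }

open OrderedRingProperties ℝ-orderedRing
  using
    (#_; F; rem-F; rem-F-nonneg; taylor-nonneg; F-nonneg⇒cubes; cubes⇒ratios; ratio-recurrence)

-- Evaluation of polynomials together with two derivatives.

-- The value and the first two derivatives at a point (not divided by factorials).
Jet : Set → Set
Jet A = A × A × A

-- Abstract in `A` so that one formula serves over ℚ for actual values and over solver expressions
-- for their symbolic form.
module JetOperations {A : Set} (_⊕_ _⊗_ : A → A → A) (⊖_ : A → A) (𝟘 𝟙 : A) where

  infixl 6 _+ⱼ_
  infixl 7 _*ⱼ_
  infixr 8 _^ⱼ_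

  constⱼ varⱼ : A → Jet A
  constⱼ c = c , 𝟘 , 𝟘
  varⱼ x   = x , 𝟙 , 𝟘

  _+ⱼ_ _*ⱼ_ : Jet A → Jet A → Jet A
  (p , p′ , p″) +ⱼ (q , q′ , q″) = (p ⊕ q) , (p′ ⊕ q′) , (p″ ⊕ q″)
  (p , p′ , p″) *ⱼ (q , q′ , q″) =
    -- The Leibniz rule; 2p′q′ is spelt as a sum because `A` supplies no numerals.
    (p ⊗ q) , ((p′ ⊗ q) ⊕ (p ⊗ q′)) , (((p″ ⊗ q) ⊕ ((p′ ⊗ q′) ⊕ (p′ ⊗ q′))) ⊕ (p ⊗ q″))

  -ⱼ_ : Jet A → Jet A
  -ⱼ (p , p′ , p″) = ⊖ p , ⊖ p′ , ⊖ p″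

  _^ⱼ_ : Jet A → ℕ → Jet A
  j ^ⱼ zero  = constⱼ 𝟙
  j ^ⱼ suc n = j *ⱼ j ^ⱼ n

  f-jet : (a a′ b b′ c d x : A) → Jet A
  f-jet a a′ b b′ c d x =
    (constⱼ ((a′ ⊗ a) ⊕ b′) *ⱼ varⱼ x +ⱼ constⱼ (a′ ⊗ b)) *ⱼ (varⱼ x +ⱼ (-ⱼ constⱼ c)) *ⱼ varⱼ x ^ⱼ 6
    +ⱼ (-ⱼ (constⱼ d *ⱼ (constⱼ a *ⱼ varⱼ x +ⱼ constⱼ b) ^ⱼ 4))

open JetOperations ℚ._+_ ℚ._*_ ℚ.-_ 0ℚ 1ℚ

-- `_/_` divides by a gcd, which does not compute for a variable `n`; unnormalised fractions avoid
-- it.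
fromℕ-suc : ∀ n → + suc n ℚ./ 1 ≡ 1ℚ ℚ.+ + n ℚ./ 1
fromℕ-suc n = ℚₚ.toℚᵘ-injective (begin
  ℚ.toℚᵘ (+ suc n ℚ./ 1)                ≈⟨ ℚₚ.toℚᵘ-fromℚᵘ (ℚᵘ.mkℚᵘ (+ suc n) 0) ⟩
  ℚᵘ.mkℚᵘ (+ suc n) 0                   ≈⟨ ℚᵘ.*≡* (≡.cong (λ i → (+ 1 ℤ.+ i) ℤ.* + 1) (≡.sym (ℤₚ.*-identityʳ (+ n)))) ⟩
  ℚᵘ.1ℚᵘ ℚᵘ.+ ℚᵘ.mkℚᵘ (+ n) 0           ≈⟨ ℚᵘₚ.+-congʳ ℚᵘ.1ℚᵘ (ℚᵘₚ.≃-sym (ℚₚ.toℚᵘ-fromℚᵘ (ℚᵘ.mkℚᵘ (+ n) 0))) ⟩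
  ℚᵘ.1ℚᵘ ℚᵘ.+ ℚ.toℚᵘ (+ n ℚ./ 1)        ≈⟨ ℚᵘₚ.≃-sym (ℚₚ.toℚᵘ-homo-+ 1ℚ (+ n ℚ./ 1)) ⟩
  ℚ.toℚᵘ (1ℚ ℚ.+ + n ℚ./ 1)             ∎)
  where
  open import Relation.Binary.Reasoning.Setoid ℚᵘₚ.≃-setoid

-- With the index `k` fixed, evaluation happens at the single rational `ξ`, so propositional
-- equality replaces `_≈_`.
module Evaluation (x : ℝ) (k : ℕ) where
  open ≡.≡-Reasoning
  open +-*-Solver

  value value′ value″ : Poly → ℚ
  value p  = seq (p ⟨ x ⟩) k
  value′ p = value (derivative p)
  value″ p = value (derivative (derivative p))

  jet : Poly → Jet ℚ
  jet p = value p , value′ p , value″ p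

  private
    ξ : ℚ
    ξ = seq x k

    ⟪_,_,_⟫ : ∀ {p q p′ q′ p″ q″ : ℚ} → p ≡ q → p′ ≡ q′ → p″ ≡ q″ → (p , p′ , p″) ≡ (q , q′ , q″)
    ⟪ ≡.refl , ≡.refl , ≡.refl ⟫ = ≡.refl

    module S {m} = JetOperations {Polynomial m} _:+_ _:*_ :-_ (con 0ℚ) (con 1ℚ)

    JetExpression : Set
    JetExpression = (ξ c d : Polynomial 9) (i j : Jet (Polynomial 9)) → Jet (Polynomial 9)

    variables : JetExpression → Jet (Polynomial 9)
    variables e = e (var 0F) (var 1F) (var 2F) (var 3F , var 4F , var 5F) (var 6F , var 7F , var 8F)

    environment : (ξ c d : ℚ) (i j : Jet ℚ) → Vec ℚ 9
    environment ξ c d (p , p′ , p″) (q , q′ , q″) =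
      ξ ∷ᵥ c ∷ᵥ d ∷ᵥ p ∷ᵥ p′ ∷ᵥ p″ ∷ᵥ q ∷ᵥ q′ ∷ᵥ q″ ∷ᵥ []ᵥ

    map-jet : (Polynomial 9 → ℚ) → Jet (Polynomial 9) → Jet ℚ
    map-jet g (p , p′ , p″) = g p , g p′ , g p″

    -- A jet identity is three rational identities. Writing both sides once, on generic jets, yields
    -- all three, and a single `refl` compares their normal forms.
    solveⱼ : (l r : JetExpression) (c d : ℚ) (i j : Jet ℚ) (let ρ = environment ξ c d i j) →
             map-jet (λ e → ⟦ e ⟧↓ ρ) (variables l) ≡ map-jet (λ e → ⟦ e ⟧↓ ρ) (variables r) →
             map-jet (λ e → ⟦ e ⟧ ρ) (variables l) ≡ map-jet (λ e → ⟦ e ⟧ ρ) (variables r)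
    solveⱼ l r c d i j eq =
      ⟪ prove ρ (proj₁ (variables l)) (proj₁ (variables r)) (≡.cong proj₁ eq)
      , prove ρ (proj₁ (proj₂ (variables l))) (proj₁ (proj₂ (variables r))) (≡.cong (λ j → proj₁ (proj₂ j)) eq)
      , prove ρ (proj₂ (proj₂ (variables l))) (proj₂ (proj₂ (variables r))) (≡.cong (λ j → proj₂ (proj₂ j)) eq) ⟫
      where ρ = environment ξ c d i j

  value-scaleFrom-suc : ∀ m p → value (scaleFrom (suc m) p) ≡ value (scaleFrom m p) ℚ.+ value p
  value-scaleFrom-suc m []      = ≡.refl
  value-scaleFrom-suc m (c ∷ p)
    rewrite fromℕ-suc m | value-scaleFrom-suc (suc m) p =
    solve 5 (λ ξ m c s v → (con 1ℚ :+ m) :* c :+ ξ :* (s :+ v)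
                        := (m :* c :+ ξ :* s) :+ (c :+ ξ :* v)) ≡.refl
      ξ (+ m ℚ./ 1) (seq c k) (value (scaleFrom (suc m) p)) (value p)

  -- `scaleFrom 0` is the Euler operator X·d/dX, while `derivative (c ∷ p)` is `scaleFrom 1 p`. The
  -- two differ by p itself, which gives (c + Xp)′ = p + Xp′.
  value-scaleFrom-zero : ∀ p → value (scaleFrom 0 p) ≡ ξ ℚ.* value′ p
  value-scaleFrom-zero []      = ≡.sym (ℚₚ.*-zeroʳ ξ)
  value-scaleFrom-zero (c ∷ p) =
    solve 3 (λ ξ c s → con 0ℚ :* c :+ ξ :* s := ξ :* s) ≡.refl
      ξ (seq c k) (value (scaleFrom 1 p))

  value′-∷ : ∀ c p → value′ (c ∷ p) ≡ value p ℚ.+ ξ ℚ.* value′ p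
  value′-∷ c p = begin
    value (scaleFrom 1 p)             ≡⟨ value-scaleFrom-suc 0 p ⟩
    value (scaleFrom 0 p) ℚ.+ value p ≡⟨ ≡.cong (ℚ._+ value p) (value-scaleFrom-zero p) ⟩
    ξ ℚ.* value′ p ℚ.+ value p        ≡⟨ ℚₚ.+-comm (ξ ℚ.* value′ p) (value p) ⟩
    value p ℚ.+ ξ ℚ.* value′ p        ∎

  -- The second derivative of `c ∷ p` is the first derivative of `scaleFrom 1 p`, so the shift rule
  -- is needed under a derivative too.
  value′-scaleFrom-suc : ∀ m p → value′ (scaleFrom (suc m) p) ≡ value′ (scaleFrom m p) ℚ.+ value′ p
  value′-scaleFrom-suc m []      = ≡.refl
  value′-scaleFrom-suc m (c ∷ p)
    rewrite value′-∷ (fromℕ (suc m) * c) (scaleFrom (suc (suc m)) p)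
          | value′-∷ (fromℕ m * c) (scaleFrom (suc m) p)
          | value′-∷ c p
          | value-scaleFrom-suc (suc m) p
          | value′-scaleFrom-suc (suc m) p =
    solve 5 (λ ξ s v s′ v′ → (s :+ v) :+ ξ :* (s′ :+ v′)
                          := (s :+ ξ :* s′) :+ (v :+ ξ :* v′)) ≡.refl
      ξ (value (scaleFrom (suc m) p)) (value p) (value′ (scaleFrom (suc m) p)) (value′ p)

  value′-scaleFrom-zero : ∀ p → value′ (scaleFrom 0 p) ≡ value′ p ℚ.+ ξ ℚ.* value″ p
  value′-scaleFrom-zero []      = solve 1 (λ ξ → con 0ℚ := con 0ℚ :+ ξ :* con 0ℚ) ≡.refl ξ
  value′-scaleFrom-zero (c ∷ p) = value′-∷ (fromℕ 0 * c) (scaleFrom 1 p)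

  -- Horner's step as a jet operation; the inductions on coefficient lists below reach derivatives
  -- of a nonempty list through it.
  jet-∷ : ∀ c p → jet (c ∷ p) ≡ constⱼ (seq c k) +ⱼ varⱼ ξ *ⱼ jet p
  jet-∷ c p = ⟪
    ≡.refl ,
    ≡.trans (value′-∷ c p)
      (solve 3 (λ ξ v v′ → v :+ ξ :* v′ := con 0ℚ :+ (con 1ℚ :* v :+ ξ :* v′)) ≡.refl
        ξ (value p) (value′ p)) ,
    (begin
      value′ (scaleFrom 1 p)
        ≡⟨ value′-scaleFrom-suc 0 p ⟩
      value′ (scaleFrom 0 p) ℚ.+ value′ p
        ≡⟨ ≡.cong (ℚ._+ value′ p) (value′-scaleFrom-zero p) ⟩
      (value′ p ℚ.+ ξ ℚ.* value″ p) ℚ.+ value′ p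
        ≡⟨ solve 4 (λ ξ v v′ v″ → (v′ :+ ξ :* v″) :+ v′
             := con 0ℚ :+ ((con 0ℚ :* v :+ (con 1ℚ :* v′ :+ con 1ℚ :* v′)) :+ ξ :* v″)) ≡.refl
             ξ (value p) (value′ p) (value″ p) ⟩
      0ℚ ℚ.+ ((0ℚ ℚ.* value p ℚ.+ (1ℚ ℚ.* value′ p ℚ.+ 1ℚ ℚ.* value′ p)) ℚ.+ ξ ℚ.* value″ p) ∎) ⟫

  jet-C : ∀ c → jet (C c) ≡ constⱼ (seq c k)
  jet-C c = ⟪ solve 2 (λ ξ c → c :+ ξ :* con 0ℚ := c) ≡.refl ξ (seq c k) , ≡.refl , ≡.refl ⟫

  jet-X : jet X ≡ varⱼ ξ
  jet-X = ⟪
    solve 1 (λ ξ → con 0ℚ :+ ξ :* (con 1ℚ :+ ξ :* con 0ℚ) := ξ) ≡.refl ξ ,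
    solve 1 (λ ξ → con 1ℚ :* con 1ℚ :+ ξ :* con 0ℚ := con 1ℚ) ≡.refl ξ ,
    ≡.refl ⟫

  jet-+ₚ : ∀ p q → jet (p +ₚ q) ≡ jet p +ⱼ jet q
  jet-+ₚ []      q       =
    ⟪ ≡.sym (ℚₚ.+-identityˡ _) , ≡.sym (ℚₚ.+-identityˡ _) , ≡.sym (ℚₚ.+-identityˡ _) ⟫
  jet-+ₚ (c ∷ p) []      =
    ⟪ ≡.sym (ℚₚ.+-identityʳ _) , ≡.sym (ℚₚ.+-identityʳ _) , ≡.sym (ℚₚ.+-identityʳ _) ⟫
  jet-+ₚ (c ∷ p) (d ∷ q) = begin
    jet ((c + d) ∷ (p +ₚ q))
      ≡⟨ jet-∷ (c + d) (p +ₚ q) ⟩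
    constⱼ (seq (c + d) k) +ⱼ varⱼ ξ *ⱼ jet (p +ₚ q)
      ≡⟨ ≡.cong (λ j → constⱼ (seq (c + d) k) +ⱼ varⱼ ξ *ⱼ j) (jet-+ₚ p q) ⟩
    constⱼ (seq (c + d) k) +ⱼ varⱼ ξ *ⱼ (jet p +ⱼ jet q)
      ≡⟨ solveⱼ (λ ξ c d i j → S.constⱼ (c :+ d) S.+ⱼ S.varⱼ ξ S.*ⱼ (i S.+ⱼ j))
           (λ ξ c d i j → (S.constⱼ c S.+ⱼ S.varⱼ ξ S.*ⱼ i) S.+ⱼ (S.constⱼ d S.+ⱼ S.varⱼ ξ S.*ⱼ j))
           (seq c k) (seq d k) (jet p) (jet q) ≡.refl ⟩
    (constⱼ (seq c k) +ⱼ varⱼ ξ *ⱼ jet p) +ⱼ (constⱼ (seq d k) +ⱼ varⱼ ξ *ⱼ jet q)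
      ≡⟨ ≡.cong₂ _+ⱼ_ (jet-∷ c p) (jet-∷ d q) ⟨
    jet (c ∷ p) +ⱼ jet (d ∷ q) ∎

  jet-scale : ∀ c p → jet (map (c *_) p) ≡ constⱼ (seq c k) *ⱼ jet p
  jet-scale c []      =
    solveⱼ (λ _ _ _ _ _ → S.constⱼ (con 0ℚ)) (λ _ c _ _ _ → S.constⱼ c S.*ⱼ S.constⱼ (con 0ℚ))
      (seq c k) 0ℚ (constⱼ 0ℚ) (constⱼ 0ℚ) ≡.refl
  jet-scale c (d ∷ p) = begin
    jet (c * d ∷ map (c *_) p)
      ≡⟨ jet-∷ (c * d) (map (c *_) p) ⟩
    constⱼ (seq (c * d) k) +ⱼ varⱼ ξ *ⱼ jet (map (c *_) p)
      ≡⟨ ≡.cong (λ j → constⱼ (seq (c * d) k) +ⱼ varⱼ ξ *ⱼ j) (jet-scale c p) ⟩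
    constⱼ (seq (c * d) k) +ⱼ varⱼ ξ *ⱼ (constⱼ (seq c k) *ⱼ jet p)
      ≡⟨ solveⱼ (λ ξ c d i _ → S.constⱼ (c :* d) S.+ⱼ S.varⱼ ξ S.*ⱼ (S.constⱼ c S.*ⱼ i))
           (λ ξ c d i _ → S.constⱼ c S.*ⱼ (S.constⱼ d S.+ⱼ S.varⱼ ξ S.*ⱼ i))
           (seq c k) (seq d k) (jet p) (jet p) ≡.refl ⟩
    constⱼ (seq c k) *ⱼ (constⱼ (seq d k) +ⱼ varⱼ ξ *ⱼ jet p)
      ≡⟨ ≡.cong (constⱼ (seq c k) *ⱼ_) (jet-∷ d p) ⟨
    constⱼ (seq c k) *ⱼ jet (d ∷ p) ∎

  jet-negate : ∀ p → jet (map -_ p) ≡ -ⱼ jet p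
  jet-negate []      = ≡.refl
  jet-negate (c ∷ p) = begin
    jet (- c ∷ map -_ p)
      ≡⟨ jet-∷ (- c) (map -_ p) ⟩
    constⱼ (seq (- c) k) +ⱼ varⱼ ξ *ⱼ jet (map -_ p)
      ≡⟨ ≡.cong (λ j → constⱼ (seq (- c) k) +ⱼ varⱼ ξ *ⱼ j) (jet-negate p) ⟩
    constⱼ (seq (- c) k) +ⱼ varⱼ ξ *ⱼ (-ⱼ jet p)
      ≡⟨ solveⱼ (λ ξ c _ i _ → S.constⱼ (:- c) S.+ⱼ S.varⱼ ξ S.*ⱼ (S.-ⱼ i))
           (λ ξ c _ i _ → S.-ⱼ (S.constⱼ c S.+ⱼ S.varⱼ ξ S.*ⱼ i))
           (seq c k) 0ℚ (jet p) (jet p) ≡.refl ⟩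
    -ⱼ (constⱼ (seq c k) +ⱼ varⱼ ξ *ⱼ jet p)
      ≡⟨ ≡.cong -ⱼ_ (jet-∷ c p) ⟨
    -ⱼ jet (c ∷ p) ∎

  jet--ₚ : ∀ p q → jet (p -ₚ q) ≡ jet p +ⱼ (-ⱼ jet q)
  jet--ₚ p q = ≡.trans (jet-+ₚ p (map -_ q)) (≡.cong (jet p +ⱼ_) (jet-negate q))

  jet-*ₚ : ∀ p q → jet (p *ₚ q) ≡ jet p *ⱼ jet q
  jet-*ₚ []      q =
    solveⱼ (λ _ _ _ _ _ → S.constⱼ (con 0ℚ)) (λ _ _ _ i _ → S.constⱼ (con 0ℚ) S.*ⱼ i)
      0ℚ 0ℚ (jet q) (jet q) ≡.refl
  jet-*ₚ (c ∷ p) q = begin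
    jet (map (c *_) q +ₚ (0ℝ ∷ p *ₚ q))
      ≡⟨ jet-+ₚ (map (c *_) q) (0ℝ ∷ p *ₚ q) ⟩
    jet (map (c *_) q) +ⱼ jet (0ℝ ∷ p *ₚ q)
      ≡⟨ ≡.cong₂ _+ⱼ_ (jet-scale c q)
           (≡.trans (jet-∷ 0ℝ (p *ₚ q)) (≡.cong (λ j → constⱼ 0ℚ +ⱼ varⱼ ξ *ⱼ j) (jet-*ₚ p q))) ⟩
    constⱼ (seq c k) *ⱼ jet q +ⱼ (constⱼ 0ℚ +ⱼ varⱼ ξ *ⱼ (jet p *ⱼ jet q))
      ≡⟨ solveⱼ (λ ξ c _ i j → S.constⱼ c S.*ⱼ j S.+ⱼ (S.constⱼ (con 0ℚ) S.+ⱼ S.varⱼ ξ S.*ⱼ (i S.*ⱼ j)))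
           (λ ξ c _ i j → (S.constⱼ c S.+ⱼ S.varⱼ ξ S.*ⱼ i) S.*ⱼ j)
           (seq c k) 0ℚ (jet p) (jet q) ≡.refl ⟩
    (constⱼ (seq c k) +ⱼ varⱼ ξ *ⱼ jet p) *ⱼ jet q
      ≡⟨ ≡.cong (_*ⱼ jet q) (jet-∷ c p) ⟨
    jet (c ∷ p) *ⱼ jet q ∎

  jet-^ₚ : ∀ p n → jet (p ^ₚ n) ≡ jet p ^ⱼ n
  jet-^ₚ p zero    = jet-C 1ℝ
  jet-^ₚ p (suc n) = ≡.trans (jet-*ₚ p (p ^ₚ n)) (≡.cong (jet p *ⱼ_) (jet-^ₚ p n))

  jet-linear : ∀ c d → jet (C c *ₚ X +ₚ C d) ≡ constⱼ (seq c k) *ⱼ varⱼ ξ +ⱼ constⱼ (seq d k)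
  jet-linear c d = ≡.trans (jet-+ₚ (C c *ₚ X) (C d))
    (≡.cong₂ _+ⱼ_ (≡.trans (jet-*ₚ (C c) X) (≡.cong₂ _*ⱼ_ (jet-C c) jet-X)) (jet-C d))

  jet-f : ∀ a b n → jet (f a b n) ≡
    f-jet (seq (a n) k) (seq (a (suc n)) k) (seq (b n) k) (seq (b (suc n)) k)
          (seq (a (n ℕ.∸ 1)) k) (seq (b (n ℕ.∸ 1)) k) ξ
  jet-f a b n = ≡.trans (jet--ₚ (L *ₚ M *ₚ X ^ₚ 6) (C d *ₚ G ^ₚ 4))
    (≡.cong₂ (λ i j → i +ⱼ (-ⱼ j))
      (≡.trans (jet-*ₚ (L *ₚ M) (X ^ₚ 6)) (≡.cong₂ _*ⱼ_
        (≡.trans (jet-*ₚ L M) (≡.cong₂ _*ⱼ_ (jet-linear A B)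
          (≡.trans (jet--ₚ X (C c)) (≡.cong₂ (λ i j → i +ⱼ (-ⱼ j)) jet-X (jet-C c)))))
        (≡.trans (jet-^ₚ X 6) (≡.cong (_^ⱼ 6) jet-X))))
      (≡.trans (jet-*ₚ (C d) (G ^ₚ 4)) (≡.cong₂ _*ⱼ_ (jet-C d)
        (≡.trans (jet-^ₚ G 4) (≡.cong (_^ⱼ 4) (jet-linear (a n) (b n)))))))
    where
    A = a (suc n) * a n + b (suc n)
    B = a (suc n) * b n
    c = a (n ℕ.∸ 1)
    d = b (n ℕ.∸ 1)
    L = C A *ₚ X +ₚ C B
    M = X -ₚ C c
    G = C (a n) *ₚ X +ₚ C (b n)

-- From the hypotheses at λ to log-convexity of the ratios.

f-taylor : ∀ a b n l x →
  # 2 * F (a n) (a (suc n)) (b n) (b (suc n)) (a (n ℕ.∸ 1)) (b (n ℕ.∸ 1)) x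
  ≈ # 2 * f a b n ⟨ l ⟩ + # 2 * derivative (f a b n) ⟨ l ⟩ * (x - l)
    + derivative (derivative (f a b n)) ⟨ l ⟩ * (x - l) ^ 2
    + # 2 * (x - l) ^ 3
      * rem-F (a n) (a (suc n)) (b n) (b (suc n)) (a (n ℕ.∸ 1)) (b (n ℕ.∸ 1)) l x
f-taylor a b n l x = pointwise
  {# 2 * F (a n) (a (suc n)) (b n) (b (suc n)) (a (n ℕ.∸ 1)) (b (n ℕ.∸ 1)) x}
  {# 2 * f a b n ⟨ l ⟩ + # 2 * derivative (f a b n) ⟨ l ⟩ * (x - l)
    + derivative (derivative (f a b n)) ⟨ l ⟩ * (x - l) ^ 2
    + # 2 * (x - l) ^ 3
      * rem-F (a n) (a (suc n)) (b n) (b (suc n)) (a (n ℕ.∸ 1)) (b (n ℕ.∸ 1)) l x}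
  λ k → ≡.trans
    (solve 8 (λ a a′ b b′ c d l x →
      let j  = f-jetₛ a a′ b b′ c d l
          t  = x :- l
          r₆ = x :^ 3 :+ ` 3 :* x :^ 2 :* l :+ ` 6 :* x :* l :^ 2 :+ ` 10 :* l :^ 3
          r₇ = x :* r₆ :+ ` 15 :* l :^ 4
      in  ` 2 :* (((a′ :* a :+ b′) :* x :+ a′ :* b) :* (x :- c) :* x :^ 6 :- d :* (a :* x :+ b) :^ 4)
      :=  ` 2 :* proj₁ j :+ ` 2 :* proj₁ (proj₂ j) :* t :+ proj₂ (proj₂ j) :* t :^ 2
          :+ ` 2 :* t :^ 3
             :* ((a′ :* a :+ b′) :* ((x :- c) :* r₇ :+ ` 21 :* l :^ 5)
                 :+ a′ :* b :* ((x :- c) :* r₆ :+ ` 15 :* l :^ 4)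
                 :- d :* (a :^ 3 :* (` 3 :* (a :* l :+ b) :+ (a :* x :+ b)))))
      ≡.refl
      (seq (a n) k) (seq (a (suc n)) k) (seq (b n) k) (seq (b (suc n)) k)
      (seq (a (n ℕ.∸ 1)) k) (seq (b (n ℕ.∸ 1)) k) (seq l k) (seq x k))
    -- The solver's identity speaks of `f-jet`; `jet-f` read backwards puts the formal derivatives
    -- of `f a b n` in its place.
    (≡.cong
      (λ (y , y′ , y″) →
        + 2 ℚ./ 1 ℚ.* y ℚ.+ + 2 ℚ./ 1 ℚ.* y′ ℚ.* seq (x - l) k ℚ.+ y″ ℚ.* seq ((x - l) ^ 2) k
        ℚ.+ seq (# 2 * (x - l) ^ 3
          * rem-F (a n) (a (suc n)) (b n) (b (suc n)) (a (n ℕ.∸ 1)) (b (n ℕ.∸ 1)) l x) k)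
      (≡.sym (Evaluation.jet-f l k a b n)))
  where
  open +-*-Solver

  `_ : ∀ {m} → ℕ → Polynomial m
  ` n = con (+ n ℚ./ 1)

  open module Symbolic {m} = JetOperations {Polynomial m} _:+_ _:*_ :-_ (con 0ℚ) (con 1ℚ)
    using () renaming (f-jet to f-jetₛ)

-- The polynomial has index `2 + n`, so that its lowest coefficients sit at `suc n`, where
-- monotonicity and positivity are assumed.
f-nonneg : ∀ a b n l x →
  (∀ m → 1 ℕ.≤ m → b m ≤ b (suc m) × 0ℝ < b m) →
  (∀ m → 1 ℕ.≤ m → a m ≤ a (suc m) × 0ℝ < a m) →
  0ℝ ≤ fromℕ 21 * a (2 ℕ.+ n) ^ 2 + fromℕ 11 * a (3 ℕ.+ n) * a (2 ℕ.+ n) - fromℕ 4 * b (suc n) →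
  l ≤ x → a (2 ℕ.+ n) ≤ l →
  0ℝ < derivative (derivative (f a b (2 ℕ.+ n))) ⟨ l ⟩ →
  0ℝ < derivative (f a b (2 ℕ.+ n)) ⟨ l ⟩ →
  0ℝ < f a b (2 ℕ.+ n) ⟨ l ⟩ →
  0ℝ ≤ F (a (2 ℕ.+ n)) (a (3 ℕ.+ n)) (b (2 ℕ.+ n)) (b (3 ℕ.+ n)) (a (suc n)) (b (suc n)) x
f-nonneg a b n l x b-mono a-mono disc l≤x a≤l 0<f″ 0<f′ 0<f =
  taylor-nonneg
    {F a₂ a₃ b₂ b₃ a₁ b₁ x} {f a b (2 ℕ.+ n) ⟨ l ⟩} {derivative (f a b (2 ℕ.+ n)) ⟨ l ⟩}
    {derivative (derivative (f a b (2 ℕ.+ n))) ⟨ l ⟩} {x - l} {rem-F a₂ a₃ b₂ b₃ a₁ b₁ l x}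
    (f-taylor a b (2 ℕ.+ n) l x)
    (<⇒≤ {0ℝ} {f a b (2 ℕ.+ n) ⟨ l ⟩} 0<f)
    (<⇒≤ {0ℝ} {derivative (f a b (2 ℕ.+ n)) ⟨ l ⟩} 0<f′)
    (<⇒≤ {0ℝ} {derivative (derivative (f a b (2 ℕ.+ n))) ⟨ l ⟩} 0<f″)
    (x≤y⇒0≤y-x {l} {x} l≤x)
    (rem-F-nonneg {a₂} {a₃} {b₂} {b₃} {a₁} {b₁} {l} {x}
      (<⇒≤ {0ℝ} {a₂} (proj₂ (a-mono (2 ℕ.+ n) 1≤))) (<⇒≤ {0ℝ} {b₁} (proj₂ (b-mono (suc n) 1≤)))
      (x≤y⇒0≤y-x {a₁} {a₂} (proj₁ (a-mono (suc n) 1≤)))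
      (x≤y⇒0≤y-x {a₂} {a₃} (proj₁ (a-mono (2 ℕ.+ n) 1≤)))
      (x≤y⇒0≤y-x {b₁} {b₂} (proj₁ (b-mono (suc n) 1≤)))
      (x≤y⇒0≤y-x {b₂} {b₃} (proj₁ (b-mono (2 ℕ.+ n) 1≤)))
      (x≤y⇒0≤y-x {a₂} {l} a≤l) (x≤y⇒0≤y-x {l} {x} l≤x)
      disc)
  where
  1≤ : ∀ {m} → 1 ℕ.≤ suc m
  1≤ = ℕ.s≤s ℕ.z≤n
  a₁ = a (suc n)
  a₂ = a (2 ℕ.+ n)
  a₃ = a (3 ℕ.+ n)
  b₁ = b (suc n)
  b₂ = b (2 ℕ.+ n)
  b₃ = b (3 ℕ.+ n)

-- Four consecutive ratios `y 0`, ..., `y 3` starting at zₙ₊₁/zₙ are tied together by three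
-- instances of the recurrence, with coefficients at n+1, n+2 and n+3.
ratio-log-convex-at : (z : ℕ → ℝ⁺) (a b : ℕ → ℝ) (n : ℕ) →
  (∀ m → 1 ℕ.≤ m → val (z (suc m)) ≈ a m * val (z m) + b m * val (z (m ℕ.∸ 1))) →
  0ℝ < b (suc n) →
  0ℝ ≤ F (a (2 ℕ.+ n)) (a (3 ℕ.+ n)) (b (2 ℕ.+ n)) (b (3 ℕ.+ n)) (a (suc n)) (b (suc n))
         (val (ratio z (suc n))) →
  val (ratio (ratio z) (suc n)) ^ 2 ≤ val (ratio (ratio z) n) * val (ratio (ratio z) (2 ℕ.+ n))
ratio-log-convex-at z a b n recurrence 0<d 0≤F =
  0≤y-x⇒x≤y {val (ratio (ratio z) (suc n)) ^ 2} {val (ratio (ratio z) n) * val (ratio (ratio z) (2 ℕ.+ n))}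
    (cubes⇒ratios {y 0} {y 1} {y 2} {y 3} {y⁻¹ 0} {y⁻¹ 1} {y⁻¹ 2}
      (y-inverse 0) (y-inverse 1) (y-inverse 2) (0≤y⁻¹ 0) (0≤y⁻¹ 1) (0≤y⁻¹ 2)
      (F-nonneg⇒cubes {a (2 ℕ.+ n)} {a (3 ℕ.+ n)} {b (2 ℕ.+ n)} {b (3 ℕ.+ n)} {a (suc n)} {b (suc n)}
        {y 0} {y 1} {y 2} {y 3} {recip d} {y⁻¹ 1} {y⁻¹ 2}
        (b≈ 0) (b≈ 1) (b≈ 2)
        (recip-inverseʳ d) (y-inverse 1) (y-inverse 2)
        (<⇒≤ {0ℝ} {recip d} (recip-pos d)) (0≤y⁻¹ 1) (0≤y⁻¹ 2)
        (<⇒≤ {0ℝ} {y 0} (pos (ratio z n)))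
        0≤F))
  where
  -- Strict positivity makes bₙ₊₁ invertible, which lets it be cancelled as a factor of y₀F(y₁).
  d : ℝ⁺
  d = mkℝ⁺ (b (suc n)) 0<d

  y y⁻¹ : ℕ → ℝ
  y i   = val (ratio z (i ℕ.+ n))
  y⁻¹ i = recip (ratio z (i ℕ.+ n))

  y-inverse : ∀ i → y i * y⁻¹ i ≈ 1ℝ
  y-inverse i = recip-inverseʳ (ratio z (i ℕ.+ n))

  0≤y⁻¹ : ∀ i → 0ℝ ≤ y⁻¹ i
  0≤y⁻¹ i = <⇒≤ {0ℝ} {y⁻¹ i} (recip-pos (ratio z (i ℕ.+ n)))

  b≈ : ∀ i → b (suc i ℕ.+ n) ≈ y (suc i) * y i - a (suc i ℕ.+ n) * y i
  b≈ i = ratio-recurrence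
    {val (z m)} {val (z (suc m))} {val (z (suc (suc m)))} {a (suc m)} {b (suc m)}
    {recip (z m)} {recip (z (suc m))}
    (recip-inverseʳ (z m)) (recip-inverseʳ (z (suc m)))
    (recurrence (suc m) (ℕ.s≤s ℕ.z≤n))
    where m = i ℕ.+ n

theorem2p1 : (z : ℕ → ℝ⁺) (a b : ℕ → ℝ) →
    (∀ n → 1 ℕ.≤ n → val (z (suc n)) ≈ a n * val (z n) + b n * val (z (n ℕ.∸ 1))) →
    (∀ n → 1 ℕ.≤ n → b n ≤ b (suc n) × 0ℝ < b n) →
    (∀ n → 1 ℕ.≤ n → a n ≤ a (suc n) × 0ℝ < a n) →
    (∀ n → 1 ℕ.≤ n →
    0ℝ ≤ fromℕ 21 * a n ^ 2 + fromℕ 11 * a (suc n) * a n - fromℕ 4 * b (n ℕ.∸ 1)) →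
    (N : ℕ) → 1 ℕ.≤ N → (lam : ℕ → ℝ) →
    (∀ n → suc N ℕ.≤ n →
    lam n ≤ val (z n ÷ z (n ℕ.∸ 1)) ×
    a n ≤ lam n ×
    0ℝ < derivative (derivative (f a b n)) ⟨ lam n ⟩ ×
    0ℝ < derivative (f a b n) ⟨ lam n ⟩ ×
    0ℝ < f a b n ⟨ lam n ⟩) →
    RatioLogConvex (from N (ratio z))
theorem2p1 z a b recurrence b-mono a-mono disc N _ lam hyp k =
  reindexed (ℕₚ.+-suc N k)
    (≡.trans (ℕₚ.+-suc N (suc k)) (≡.cong suc (ℕₚ.+-suc N k)))
    (≡.trans (ℕₚ.+-suc N (suc (suc k)))
      (≡.cong suc (≡.trans (ℕₚ.+-suc N (suc k)) (≡.cong suc (ℕₚ.+-suc N k)))))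
  where
  n : ℕ
  n = N ℕ.+ k

  0≤F : 0ℝ ≤ F (a (2 ℕ.+ n)) (a (3 ℕ.+ n)) (b (2 ℕ.+ n)) (b (3 ℕ.+ n)) (a (suc n)) (b (suc n))
               (val (ratio z (suc n)))
  0≤F =
    let l≤x , a≤l , 0<f″ , 0<f′ , 0<f =
          -- `F` is evaluated at the second of the four ratios, zₙ₊₂/zₙ₊₁, so λ is taken at `2 + n`.
          hyp (2 ℕ.+ n) (ℕ.s≤s (ℕₚ.≤-trans (ℕₚ.m≤m+n N k) (ℕₚ.n≤1+n n)))
    in f-nonneg a b n (lam (2 ℕ.+ n)) (val (ratio z (suc n))) b-mono a-mono
         (disc (2 ℕ.+ n) (ℕ.s≤s ℕ.z≤n)) l≤x a≤l 0<f″ 0<f′ 0<f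

  -- `N + suc k` equals `suc (N + k)` only propositionally; with the indices as variables, matching
  -- on `refl` replaces all their occurrences together.
  reindexed : ∀ {i₁ i₂ i₃} → i₁ ≡ 1 ℕ.+ n → i₂ ≡ 2 ℕ.+ n → i₃ ≡ 3 ℕ.+ n →
    val (ratio z i₂ ÷ ratio z i₁) ^ 2 ≤
    val (ratio z i₁ ÷ ratio z n) * val (ratio z i₃ ÷ ratio z i₂)
  reindexed ≡.refl ≡.refl ≡.refl =
    ratio-log-convex-at z a b n recurrence (proj₂ (b-mono (suc n) (ℕ.s≤s ℕ.z≤n))) 0≤F
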